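{- Let $A,B\in\mathbb{Z}$ with $A\equiv B\equiv 1\pmod 4$, and let $\mathcal{F}_{2,A,B}(x)=x^{4}+Ax^{3}+Bx^{2}+Ax+1$. Put $W_1=B+2-2A$, $W_2=B+2+2A$, $W_3=A^2-4B+8$. Then $\mathcal{F}_{2,A,B}(x)$ is monogenic if and only if $W_1$, $W_2$ and $W_3$ are all squarefree.
   Context: A monic polynomial $f(x)\in\mathbb{Z}[x]$ is called monogenic if $f(x)$ is irreducible over $\mathbb{Q}$ and $\{1,\theta,\theta^2,\ldots,\theta^{\deg f-1}\}$ is a $\mathbb{Z}$-basis of the ring of integers $\mathbb{Z}_K$ of $K=\mathbb{Q}(\theta)$, where $f(\theta)=0$; equivalently $\mathbb{Z}_K=\mathbb{Z}[\theta]$. -}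

module Defs where

open import Data.Nat using (ℕ; zero; suc; _≤_)
open import Data.Integer as ℤ using (ℤ; +_)
open import Data.Integer.Divisibility as ℤD using ()
open import Data.Rational as ℚ using (ℚ; 0ℚ; 1ℚ)
open import Data.List using (List; []; _∷_; map; _++_; [_])
open import Data.Product using (Σ; ∃; _×_; _,_)
open import Relation.Binary.PropositionalEquality using (_≡_)
open import Relation.Nullary using (¬_)

-- Polynomials over ℚ as coefficient lists, lowest degree first.
PolyQ : Set
PolyQ = List ℚ

coeff : PolyQ → ℕ → ℚ
coeff []       _       = 0ℚ
coeff (c ∷ p)  zero    = c
coeff (c ∷ p)  (suc n) = coeff p n

-- equality of polynomials (ignoring trailing zeros)
_≈ₚ_ : PolyQ → PolyQ → Set
p ≈ₚ q = ∀ n → coeff p n ≡ coeff q n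

_+ₚ_ : PolyQ → PolyQ → PolyQ
[]      +ₚ q       = q
(a ∷ p) +ₚ []      = a ∷ p
(a ∷ p) +ₚ (b ∷ q) = (a ℚ.+ b) ∷ (p +ₚ q)

-ₚ_ : PolyQ → PolyQ
-ₚ p = map ℚ.-_ p

_-ₚ_ : PolyQ → PolyQ → PolyQ
p -ₚ q = p +ₚ (-ₚ q)

_*ₚ_ : PolyQ → PolyQ → PolyQ
[]      *ₚ q = []
(a ∷ p) *ₚ q = map (a ℚ.*_) q +ₚ (0ℚ ∷ (p *ₚ q))

evalAt : PolyQ → PolyQ → PolyQ
evalAt []      α = []
evalAt (c ∷ g) α = [ c ] +ₚ (α *ₚ evalAt g α)

_∣ₚ_ : PolyQ → PolyQ → Set
f ∣ₚ p = Σ PolyQ λ q → (q *ₚ f) ≈ₚ p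

PosDeg : PolyQ → Set
PosDeg g = Σ ℕ λ n → (1 ≤ n) × ¬ (coeff g n ≡ 0ℚ)

IrreducibleQ : PolyQ → Set
IrreducibleQ f = PosDeg f × ¬ (Σ PolyQ λ g → Σ PolyQ λ h → PosDeg g × PosDeg h × ((g *ₚ h) ≈ₚ f))

toQ : ℤ → ℚ
toQ z = z ℚ./ 1

intPoly : List ℤ → PolyQ
intPoly cs = map toQ cs

monic : List ℤ → PolyQ
monic cs = intPoly cs ++ [ 1ℚ ]

-- Monogenicity of the monic polynomial f = monic cs.
-- K = ℚ(θ) ≅ ℚ[x]/(f), θ ↦ x; an element is represented by α ∈ ℚ[x].
-- α is an algebraic integer iff g(α) ≡ 0 mod f for some monic g ∈ ℤ[x];
-- α ∈ ℤ[θ] iff α ≡ β mod f for some β ∈ ℤ[x].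
-- ℤ[θ] ⊆ ℤ_K always holds, so ℤ_K = ℤ[θ] amounts to ℤ_K ⊆ ℤ[θ];
-- and ℤ[θ] has ℤ-basis 1,θ,…,θ^(n-1) as f is monic.
Monogenic : List ℤ → Set
Monogenic cs =
  IrreducibleQ (monic cs) ×
  (∀ (α : PolyQ) →
     (Σ (List ℤ) λ g → monic cs ∣ₚ evalAt (monic g) α) →
     Σ (List ℤ) λ β → monic cs ∣ₚ (α -ₚ intPoly β))

-- squarefree integer: no square of a non-unit divides it (so 0 is not squarefree)
Squarefree : ℤ → Set
Squarefree w = ∀ (d : ℤ) → (d ℤ.* d) ℤD.∣ w → ℤ.∣ d ∣ ≡ 1

F2 : ℤ → ℤ → List ℤ
F2 A B = + 1 ∷ A ∷ B ∷ A ∷ []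

{-# OPTIONS --safe #-}

-- K = ℚ(θ) is a tower of quadratic extensions: η = θ + θ⁻¹ satisfies η² + A η + B − 2 = 0, of
-- discriminant W₃, and θ² − η θ + 1 = 0 has discriminant η² − 4, of norm W₁ W₂.  An element a of
-- either layer is almost integral (some d ≠ 0 clears the denominators of all its powers) whenever
-- it is integral, and almost integral elements form a ring stable under conjugation; hence for
-- a = x + y t both y·disc and y²·disc are almost integral in the layer below, and squarefreeness
-- of the discriminants forces y, and then x, to be integral.  Conversely d² ∣ W₁, W₂ or W₃ yields
-- an explicit integral element with denominator d.  Irreducibility holds for all odd A and B: the
-- norm form of K is anisotropic modulo 2, so it has no nontrivial zero and K is a domain.
module Submission where

open import Defs
open import Level using (0ℓ)
open import Algebra.Core using (Op₁; Op₂)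
open import Algebra.Bundles using (CommutativeRing)
open import Algebra.Structures using (IsCommutativeRing)
open import Algebra.Solver.Ring.AlmostCommutativeRing using (fromCommutativeRing; _-Raw-AlmostCommutative⟶_)
import Algebra.Solver.Ring as RingSolver
import Algebra.Properties.CommutativeSemiring.Exp as Exp
open import Data.Empty using (⊥-elim)
open import Data.Integer as ℤ using (ℤ; +_; -[1+_])
import Data.Integer.Properties as ℤP
import Data.Integer.Divisibility as ℤD
import Data.Integer.Divisibility.Signed as Signed
open import Data.List using (List; []; _∷_; map; [_]; length)
import Data.Maybe.Base as Maybe
open import Data.Nat as ℕ using (ℕ; zero; suc; parity)
import Data.Nat.Properties as ℕP
import Data.Nat.Divisibility as ℕD
open import Data.Nat.Coprimality as Coprimality using (Coprime; coprime-divisor)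
open import Data.Parity as ℙ using (Parity; 0ℙ; 1ℙ)
import Data.Parity.Properties as ℙP
open import Data.Product using (Σ; _×_; _,_; proj₁; proj₂)
open import Data.Rational as ℚ using (ℚ; mkℚ; 0ℚ; 1ℚ; ↥_; ↧_; ↧ₙ_; toℚᵘ)
import Data.Rational.Properties as ℚP
open import Data.Rational.Unnormalised as ℚᵘ using (ℚᵘ; mkℚᵘ; *≡*)
import Data.Rational.Unnormalised.Properties as ℚᵘP
open import Data.Sum using (_⊎_; inj₁; inj₂; [_,_]′)
open import Function.Bundles using (_⇔_; mk⇔)
open import Relation.Binary.Consequences using (dec⇒weaklyDec)
open import Relation.Binary.Definitions using (tri<; tri≈; tri>)
open import Relation.Binary.PropositionalEquality
  using (_≡_; refl; sym; trans; cong; cong₂; subst; isEquivalence; module ≡-Reasoning)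
open import Relation.Nullary using (¬_; yes; no)

-- Quadratic extensions

-- Almost integral elements replace integral ones because sums become elementary: a monic equation
-- for a sum would have to be built from resultants or determinants, whereas common denominators of
-- powers simply multiply. The difficulty sits in the upper layer. In ℤ[η] fractions need not have
-- lowest terms, so squarefreeness of η² - 4 has to be read off from integers. With P(y) = y² + A y
-- + B - 2 one has P(2) = W₂ and P(-2) = W₁, and these two evaluations control v₀ + v₁ η only up to
-- the factor 4 = 2 - (-2). The congruences on A and B give W₁ W₂ ≡ 1 modulo 4, and since v W₁ W₂ is
-- integral as well, the factor 4 disappears. The explicit elements for W₁ and W₂ come from (θ - s)²
-- = θ (η - 2s) with s = ±1: if d² divides the norm of η - 2s, then θ - s times the conjugate of η -
-- 2s may be divided by d.

record ℤ-Algebra : Set₁ where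
  infixl 6 _+_
  infixl 7 _*_
  infix 8 -_
  field
    Carrier           : Set
    _+_ _*_           : Op₂ Carrier
    -_                : Op₁ Carrier
    ι                 : ℤ → Carrier
    isCommutativeRing : IsCommutativeRing _≡_ _+_ _*_ -_ (ι (+ 0)) (ι (+ 1))
    ι-+               : ∀ i j → ι (i ℤ.+ j) ≡ ι i + ι j
    ι-*               : ∀ i j → ι (i ℤ.* j) ≡ ι i * ι j
    ι-neg             : ∀ i → ι (ℤ.- i) ≡ - ι i

  0# 1# : Carrier
  0# = ι (+ 0)
  1# = ι (+ 1)

  commutativeRing : CommutativeRing 0ℓ 0ℓ
  commutativeRing = record { isCommutativeRing = isCommutativeRing }

  open CommutativeRing commutativeRing public
    using (+-comm; +-assoc; +-identityˡ; +-identityʳ; -‿inverseˡ; -‿inverseʳ;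
           *-comm; *-assoc; *-identityˡ; *-identityʳ; zeroˡ; zeroʳ; distribˡ; distribʳ;
           commutativeSemiring)
  open Exp commutativeSemiring public

  opaque
    -- The final `x * 0#` copies what evaluating a four-element coefficient list produces, so that
    -- `eval-cubic` is `refl`.
    cubic : (c₀ c₁ c₂ c₃ x : Carrier) → Carrier
    cubic c₀ c₁ c₂ c₃ x = c₀ + x * (c₁ + x * (c₂ + x * (c₃ + x * 0#)))

    -- The value at a of the monic polynomial with lower coefficients cs.
    horner : List ℤ → Carrier → Carrier
    horner []       a = 1#
    horner (c ∷ cs) a = ι c + a * horner cs a

  ℤ-coefficients : ℤ.+-*-rawRing -Raw-AlmostCommutative⟶ fromCommutativeRing commutativeRing
  ℤ-coefficients = record
    { ⟦_⟧ = ι ; +-homo = ι-+ ; *-homo = ι-* ; -‿homo = ι-neg ; 0-homo = refl ; 1-homo = refl }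

  -- Coefficients are integers mapped in by `ι`, so constants are computed and compared in ℤ
  -- whatever the carrier is.
  module Solver = RingSolver ℤ.+-*-rawRing (fromCommutativeRing commutativeRing) ℤ-coefficients
    (λ i j → Maybe.map (cong ι) (dec⇒weaklyDec ℤP._≟_ i j))

-- The ring R[t]/(t² − p t − q); the pair (x , y) stands for x + y t.
module Quadratic (R : ℤ-Algebra) (p q : ℤ-Algebra.Carrier R) where
  open ℤ-Algebra R
  open Solver

  private
    Elem : Set
    Elem = Carrier × Carrier

    add mul : Op₂ Elem
    add a b = proj₁ a + proj₁ b , proj₂ a + proj₂ b
    mul a b = proj₁ a * proj₁ b + q * (proj₂ a * proj₂ b)
            , proj₁ a * proj₂ b + proj₂ a * proj₁ b + p * (proj₂ a * proj₂ b)

    mul-assoc : ∀ a b c → mul (mul a b) c ≡ mul a (mul b c)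
    mul-assoc (x , y) (z , w) (u , v) = cong₂ _,_
      (solve 8 (λ p q x y z w u v →
        (x :* z :+ q :* (y :* w)) :* u :+ q :* ((x :* w :+ y :* z :+ p :* (y :* w)) :* v)
        := x :* (z :* u :+ q :* (w :* v)) :+ q :* (y :* (z :* v :+ w :* u :+ p :* (w :* v))))
        refl p q x y z w u v)
      (solve 8 (λ p q x y z w u v →
        (x :* z :+ q :* (y :* w)) :* v :+ (x :* w :+ y :* z :+ p :* (y :* w)) :* u
          :+ p :* ((x :* w :+ y :* z :+ p :* (y :* w)) :* v)
        := x :* (z :* v :+ w :* u :+ p :* (w :* v)) :+ y :* (z :* u :+ q :* (w :* v))
          :+ p :* (y :* (z :* v :+ w :* u :+ p :* (w :* v))))
        refl p q x y z w u v)

    mul-comm : ∀ a b → mul a b ≡ mul b a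
    mul-comm (x , y) (z , w) = cong₂ _,_
      (solve 5 (λ q x y z w → x :* z :+ q :* (y :* w) := z :* x :+ q :* (w :* y)) refl q x y z w)
      (solve 5 (λ p x y z w → x :* w :+ y :* z :+ p :* (y :* w) := z :* y :+ w :* x :+ p :* (w :* y))
        refl p x y z w)

    mul-identityˡ : ∀ a → mul (1# , 0#) a ≡ a
    mul-identityˡ (x , y) = cong₂ _,_
      (solve 3 (λ q x y → con (+ 1) :* x :+ q :* (con (+ 0) :* y) := x) refl q x y)
      (solve 3 (λ p x y → con (+ 1) :* y :+ con (+ 0) :* x :+ p :* (con (+ 0) :* y) := y) refl p x y)

    mul-distribˡ : ∀ a b c → mul a (add b c) ≡ add (mul a b) (mul a c)
    mul-distribˡ (x , y) (z , w) (u , v) = cong₂ _,_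
      (solve 7 (λ q x y z w u v → x :* (z :+ u) :+ q :* (y :* (w :+ v))
        := x :* z :+ q :* (y :* w) :+ (x :* u :+ q :* (y :* v))) refl q x y z w u v)
      (solve 7 (λ p x y z w u v → x :* (w :+ v) :+ y :* (z :+ u) :+ p :* (y :* (w :+ v))
        := x :* w :+ y :* z :+ p :* (y :* w) :+ (x :* v :+ y :* u :+ p :* (y :* v))) refl p x y z w u v)

  private
    neg : Elem → Elem
    neg a = - proj₁ a , - proj₂ a

    inject : ℤ → Elem
    inject i = ι i , 0#

  opaque
    isCommutativeRing′ : IsCommutativeRing _≡_ add mul neg (inject (+ 0)) (inject (+ 1))
    isCommutativeRing′ =
        record
        { isRing = record
          { +-isAbelianGroup = record
            { isGroup = record
              { isMonoid = record
                { isSemigroup = record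
                  { isMagma = record { isEquivalence = isEquivalence ; ∙-cong = cong₂ add }
                  ; assoc = λ a b c → cong₂ _,_ (+-assoc _ _ _) (+-assoc _ _ _) }
                ; identity = (λ a → cong₂ _,_ (+-identityˡ _) (+-identityˡ _))
                           , (λ a → cong₂ _,_ (+-identityʳ _) (+-identityʳ _)) }
              ; inverse = (λ a → cong₂ _,_ (-‿inverseˡ _) (-‿inverseˡ _))
                        , (λ a → cong₂ _,_ (-‿inverseʳ _) (-‿inverseʳ _))
              ; ⁻¹-cong = cong (λ a → - proj₁ a , - proj₂ a) }
            ; comm = λ a b → cong₂ _,_ (+-comm _ _) (+-comm _ _) }
          ; *-cong = cong₂ mul
          ; *-assoc = mul-assoc
          ; *-identity = mul-identityˡ , (λ a → trans (mul-comm a _) (mul-identityˡ a))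
          ; distrib = mul-distribˡ , (λ a b c → trans (mul-comm _ a) (trans (mul-distribˡ a b c)
              (cong₂ add (mul-comm a b) (mul-comm a c)))) }
        ; *-comm = mul-comm }

    inject-+ : ∀ i j → inject (i ℤ.+ j) ≡ add (inject i) (inject j)
    inject-+ = λ i j → cong₂ _,_ (ι-+ i j) (sym (+-identityˡ 0#))

    inject-* : ∀ i j → inject (i ℤ.* j) ≡ mul (inject i) (inject j)
    inject-* = λ i j → cong₂ _,_
        (trans (ι-* i j) (solve 3 (λ q x y → x :* y := x :* y :+ q :* (con (+ 0) :* con (+ 0)))
          refl q (ι i) (ι j)))
        (solve 3 (λ p x y → con (+ 0) := x :* con (+ 0) :+ con (+ 0) :* y :+ p :* (con (+ 0) :* con (+ 0)))
          refl p (ι i) (ι j))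

    inject-neg : ∀ i → inject (ℤ.- i) ≡ neg (inject i)
    inject-neg = λ i → cong₂ _,_ (ι-neg i) (ι-neg (+ 0))

  quadratic : ℤ-Algebra
  quadratic = record
    { Carrier = Elem ; _+_ = add ; _*_ = mul ; -_ = neg ; ι = inject
    ; isCommutativeRing = isCommutativeRing′
    ; ι-+ = inject-+ ; ι-* = inject-* ; ι-neg = inject-neg }

  embed : Carrier → Elem
  embed x = x , 0#

  embed-+ : ∀ x y → embed (x + y) ≡ add (embed x) (embed y)
  embed-+ x y = cong (x + y ,_) (sym (+-identityˡ 0#))

  embed-scale : ∀ c x y → mul (embed c) (x , y) ≡ (c * x , c * y)
  embed-scale c x y = cong₂ _,_
    (solve 4 (λ q c x y → c :* x :+ q :* (con (+ 0) :* y) := c :* x) refl q c x y)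
    (solve 4 (λ p c x y → c :* y :+ con (+ 0) :* x :+ p :* (con (+ 0) :* y) := c :* y) refl p c x y)

  embed-* : ∀ x y → embed (x * y) ≡ mul (embed x) (embed y)
  embed-* x y = trans (cong (x * y ,_) (sym (zeroʳ x))) (sym (embed-scale x y 0#))

  -- The second root of t² - p t - q is p - t.
  conj : Elem → Elem
  conj (x , y) = x + p * y , - y

  conj-* : ∀ a b → conj (mul a b) ≡ mul (conj a) (conj b)
  conj-* (x , y) (z , w) = cong₂ _,_
    (solve 6 (λ p q x y z w → x :* z :+ q :* (y :* w) :+ p :* (x :* w :+ y :* z :+ p :* (y :* w))
      := (x :+ p :* y) :* (z :+ p :* w) :+ q :* (:- y :* :- w)) refl p q x y z w)
    (solve 6 (λ p q x y z w → :- (x :* w :+ y :* z :+ p :* (y :* w))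
      := (x :+ p :* y) :* :- w :+ :- y :* (z :+ p :* w) :+ p :* (:- y :* :- w)) refl p q x y z w)

  conj-embed : ∀ x → conj (embed x) ≡ embed x
  conj-embed x = cong₂ _,_
    (solve 2 (λ p x → x :+ p :* con (+ 0) := x) refl p x)
    (solve 0 (:- con (+ 0) := con (+ 0)) refl)

  norm : Elem → Carrier
  norm (x , y) = x * x + p * (x * y) + - q * (y * y)

  conj-norm : ∀ a → mul (conj a) a ≡ embed (norm a)
  conj-norm (x , y) = cong₂ _,_
    (solve 4 (λ p q x y → (x :+ p :* y) :* x :+ q :* (:- y :* y)
      := x :* x :+ p :* (x :* y) :+ :- q :* (y :* y)) refl p q x y)
    (solve 4 (λ p q x y → (x :+ p :* y) :* y :+ :- y :* x :+ p :* (:- y :* y) := con (+ 0)) refl p q x y)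

  norm-scale : ∀ c x y → norm (c * x , c * y) ≡ c * c * norm (x , y)
  norm-scale c x y = solve 5 (λ p q c x y →
    c :* x :* (c :* x) :+ p :* (c :* x :* (c :* y)) :+ :- q :* (c :* y :* (c :* y))
    := c :* c :* (x :* x :+ p :* (x :* y) :+ :- q :* (y :* y))) refl p q c x y

  -- Multiplying by the conjugate of a moves the relation into the base ring without any division.
  -- Applied to both layers it reduces zero divisors of the tower to zero divisors of the base.
  norm-annihilates : ∀ {a x y} → mul a (x , y) ≡ (0# , 0#) → norm a * x ≡ 0# × norm a * y ≡ 0#
  norm-annihilates {a} {x} {y} ab≡0 = cong proj₁ product≡0 , cong proj₂ product≡0
    where
    open ≡-Reasoning
    product≡0 : (norm a * x , norm a * y) ≡ (0# , 0#)
    product≡0 = begin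
      norm a * x , norm a * y        ≡⟨ embed-scale (norm a) x y ⟨
      mul (embed (norm a)) (x , y)   ≡⟨ cong (λ n → mul n (x , y)) (conj-norm a) ⟨
      mul (mul (conj a) a) (x , y)   ≡⟨ mul-assoc (conj a) a (x , y) ⟩
      mul (conj a) (mul a (x , y))   ≡⟨ cong (mul (conj a)) ab≡0 ⟩
      mul (conj a) (0# , 0#)         ≡⟨ mul-comm (conj a) (0# , 0#) ⟩
      mul (0# , 0#) (conj a)         ≡⟨ ℤ-Algebra.zeroˡ quadratic (conj a) ⟩
      0# , 0#                        ∎

  disc : Carrier
  disc = p * p + ι (+ 4) * q

-- Almost integral elements

*-≢0 : ∀ {d e} → ¬ d ≡ + 0 → ¬ e ≡ + 0 → ¬ (d ℤ.* e) ≡ + 0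
*-≢0 {d} d≢0 e≢0 de≡0 = [ d≢0 , e≢0 ]′ (ℤP.i*j≡0⇒i≡0∨j≡0 d de≡0)

-- A subring is given as a predicate, so its elements stay in the ambient algebra and need no
-- coercion. The field `clear` says that the subring spans the algebra over ℚ.
record Order (R : ℤ-Algebra) : Set₁ where
  open ℤ-Algebra R
  open Solver
  field
    Mem   : Carrier → Set
    Mem-+ : ∀ {a b} → Mem a → Mem b → Mem (a + b)
    Mem-* : ∀ {a b} → Mem a → Mem b → Mem (a * b)
    Mem-ι : ∀ i → Mem (ι i)
    clear : ∀ a → Σ ℤ λ d → ¬ (d ≡ + 0) × Mem (ι d * a)

  Mem-neg : ∀ {a} → Mem a → Mem (- a)
  Mem-neg {a} m = subst Mem (solve 1 (λ a → con -[1+ 0 ] :* a := :- a) refl a) (Mem-* (Mem-ι -[1+ 0 ]) m)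

  Mem-- : ∀ {a b} → Mem a → Mem b → Mem (a + - b)
  Mem-- m n = Mem-+ m (Mem-neg n)

  Mem-^ : ∀ {a} → Mem a → ∀ n → Mem (a ^ n)
  Mem-^ m zero    = Mem-ι (+ 1)
  Mem-^ m (suc n) = Mem-* m (Mem-^ m n)

  opaque
    AlmostIntegral : Carrier → Set
    AlmostIntegral a = Σ ℤ λ d → ¬ (d ≡ + 0) × (∀ n → Mem (ι d * a ^ n))

  IntegrallyClosed : Set
  IntegrallyClosed = ∀ {a} → AlmostIntegral a → Mem a

  opaque
    unfolding AlmostIntegral

    Mem⇒AI : ∀ {a} → Mem a → AlmostIntegral a
    Mem⇒AI m = + 1 , (λ ()) , λ n → Mem-* (Mem-ι (+ 1)) (Mem-^ m n)

    AI-* : ∀ {a b} → AlmostIntegral a → AlmostIntegral b → AlmostIntegral (a * b)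
    AI-* {a} {b} (d , d≢0 , da) (e , e≢0 , eb) = d ℤ.* e , *-≢0 d≢0 e≢0 , λ n →
      subst Mem
        (trans (solve 4 (λ d e x y → d :* x :* (e :* y)
            := d :* e :* (x :* y)) refl (ι d) (ι e) (a ^ n) (b ^ n))
          (cong₂ _*_ (sym (ι-* d e)) (sym (^-distrib-* a b n))))
        (Mem-* (da n) (eb n))

    AI-+ : ∀ {a b} → AlmostIntegral a → AlmostIntegral b → AlmostIntegral (a + b)
    AI-+ {a} {b} (d , d≢0 , da) (e , e≢0 , eb) = d ℤ.* e , *-≢0 d≢0 e≢0 , λ n →
      subst Mem
        (trans (solve 3 (λ d e x → d :* e :* (x :* (con (+ 1) :* con (+ 1)))
            := d :* e :* x) refl (ι d) (ι e) ((a + b) ^ n))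
          (cong (_* (a + b) ^ n) (sym (ι-* d e))))
        (mixed n 0 0)
      where
      -- Carrying a monomial along avoids binomial coefficients: each factor a + b is split and
      -- raises either i or j, and every resulting a^i b^j is cleared by the same d e.
      mixed : ∀ n i j → Mem (ι d * ι e * ((a + b) ^ n * (a ^ i * b ^ j)))
      mixed zero i j = subst Mem
        (solve 4 (λ d e x y → d :* x :* (e :* y)
            := d :* e :* (con (+ 1) :* (x :* y))) refl (ι d) (ι e) (a ^ i) (b ^ j))
        (Mem-* (da i) (eb j))
      mixed (suc n) i j = subst Mem
        (solve 6 (λ k s a b x y → k :* (s :* (a :* x :* y)) :+ k :* (s :* (x :* (b :* y)))
                   := k :* ((a :+ b) :* s :* (x :* y)))
          refl (ι d * ι e) ((a + b) ^ n) a b (a ^ i) (b ^ j))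
        (Mem-+ (mixed n (suc i) j) (mixed n i (suc j)))

  AI-neg : ∀ {a} → AlmostIntegral a → AlmostIntegral (- a)
  AI-neg {a} ai = subst AlmostIntegral (solve 1 (λ a → con -[1+ 0 ] :* a := :- a) refl a)
    (AI-* (Mem⇒AI (Mem-ι -[1+ 0 ])) ai)

  clearPowers : ∀ a m → Σ ℤ λ d → ¬ (d ≡ + 0) × (∀ i → i ℕ.< m → Mem (ι d * a ^ i))
  clearPowers a zero = + 1 , (λ ()) , λ _ ()
  clearPowers a (suc m) with clearPowers a m | clear (a ^ m)
  ... | d , d≢0 , low | e , e≢0 , top = d ℤ.* e , *-≢0 d≢0 e≢0 , all
    where
    all : ∀ i → i ℕ.< suc m → Mem (ι (d ℤ.* e) * a ^ i)
    all i i<1+m with i ℕP.≟ m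
    ... | yes refl = subst Mem
      (trans (solve 3 (λ d e x → d :* (e :* x) := d :* e :* x) refl (ι d) (ι e) (a ^ m))
        (cong (_* a ^ m) (sym (ι-* d e))))
      (Mem-* (Mem-ι d) top)
    ... | no i≢m = subst Mem
      (trans (solve 3 (λ d e x → e :* (d :* x) := d :* e :* x) refl (ι d) (ι e) (a ^ i))
        (cong (_* a ^ i) (sym (ι-* d e))))
      (Mem-* (Mem-ι e) (low i (ℕP.≤∧≢⇒< (ℕ.s≤s⁻¹ i<1+m) i≢m)))

  opaque
    unfolding horner

    -- The lower terms are subtracted one at a time. The spare factor x absorbs the shift of
    -- exponents: after removing the constant term c x, what remains is the same claim for the other
    -- coefficients with a x in place of x.
    lastTerm : ∀ cs {a} k x → (∀ i → i ℕ.< length cs → Mem (k * (a ^ i * x))) →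
               Mem (k * (horner cs a * x)) → Mem (k * (a ^ length cs * x))
    lastTerm []       k x low h = h
    lastTerm (c ∷ cs) {a} k x low h = subst Mem
      (solve 4 (λ k s a x → k :* (s :* (a :* x)) := k :* (a :* s :* x)) refl k (a ^ length cs) a x)
      (lastTerm cs k (a * x)
        (λ i i<l → subst Mem
          (solve 4 (λ k s a x → k :* (a :* s :* x) := k :* (s :* (a :* x))) refl k (a ^ i) a x)
          (low (suc i) (ℕ.s≤s i<l)))
        (subst Mem
          (solve 5 (λ k c a r x → k :* ((c :+ a :* r) :* x) :+ :- (c :* (k :* (con (+ 1) :* x)))
              := k :* (r :* (a :* x)))
            refl k (ι c) a (horner cs a) x)
          (Mem-- h (Mem-* (Mem-ι c) (low 0 (ℕ.s≤s ℕ.z≤n))))))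

  opaque
    unfolding AlmostIntegral

    -- One d clears the finitely many powers below the degree m. For i ≥ m the monic equation times
    -- a^(i ∸ m) writes a^i through smaller powers with integer coefficients, so no new denominator
    -- arises. The bound k in `all` makes this a strong induction on i.
    monicRoot⇒AI : ∀ cs {a} → horner cs a ≡ 0# → AlmostIntegral a
    monicRoot⇒AI cs {a} root with clearPowers a (length cs)
    ... | d , d≢0 , low = d , d≢0 , λ n → all (suc n) n ℕP.≤-refl
      where
      m : ℕ
      m = length cs
      all : ∀ k i → i ℕ.< k → Mem (ι d * a ^ i)
      all (suc k) i (ℕ.s≤s i≤k) with i ℕP.<? m
      ... | yes i<m = low i i<m
      ... | no i≮m = subst (λ i → Mem (ι d * a ^ i)) (ℕP.m+[n∸m]≡n m≤i)
        (subst (λ y → Mem (ι d * y)) (sym (^-homo-* a m (i ℕ.∸ m)))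
          (lastTerm cs (ι d) (a ^ (i ℕ.∸ m))
            (λ j j<m → subst (λ y → Mem (ι d * y)) (^-homo-* a j (i ℕ.∸ m))
              (all k (j ℕ.+ (i ℕ.∸ m)) (ℕP.<-≤-trans
                (subst (j ℕ.+ (i ℕ.∸ m) ℕ.<_) (ℕP.m+[n∸m]≡n m≤i) (ℕP.+-monoˡ-< (i ℕ.∸ m) j<m)) i≤k)))
            (subst Mem
              (trans (solve 2 (λ d x → con (+ 0) := d :* (con (+ 0) :* x)) refl (ι d) (a ^ (i ℕ.∸ m)))
                (cong (λ h → ι d * (h * a ^ (i ℕ.∸ m))) (sym root)))
              (Mem-ι (+ 0)))))
        where
        m≤i : m ℕ.≤ i
        m≤i = ℕP.≮⇒≥ i≮m

module QuadraticOrder {R : ℤ-Algebra} (O : Order R) {p q} (p∈O : Order.Mem O p) (q∈O : Order.Mem O q) where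
  open ℤ-Algebra R
  open Solver
  open Order O
  open Quadratic R p q
  private module Q = ℤ-Algebra quadratic

  quadraticOrder : Order quadratic
  quadraticOrder = record
    { Mem   = λ a → Mem (proj₁ a) × Mem (proj₂ a)
    ; Mem-+ = λ (x , y) (z , w) → Mem-+ x z , Mem-+ y w
    ; Mem-* = λ (x , y) (z , w) → Mem-+ (Mem-* x z) (Mem-* q∈O (Mem-* y w))
                                , Mem-+ (Mem-+ (Mem-* x w) (Mem-* y z)) (Mem-* p∈O (Mem-* y w))
    ; Mem-ι = λ i → Mem-ι i , Mem-ι (+ 0)
    ; clear = clearPair }
    where
    clearPair : ∀ a → Σ ℤ λ d → ¬ (d ≡ + 0) × (Mem (proj₁ (Q.ι d Q.* a)) × Mem (proj₂ (Q.ι d Q.* a)))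
    clearPair (x , y) with clear x | clear y
    ... | d , d≢0 , dx | e , e≢0 , ey = d ℤ.* e , *-≢0 d≢0 e≢0 ,
      subst (λ a → Mem (proj₁ a) × Mem (proj₂ a)) (sym (embed-scale (ι (d ℤ.* e)) x y))
        ( subst Mem (trans (solve 3 (λ d e x → e :* (d :* x) := d :* e :* x) refl (ι d) (ι e) x)
            (cong (_* x) (sym (ι-* d e)))) (Mem-* (Mem-ι e) dx)
        , subst Mem (trans (solve 3 (λ d e x → d :* (e :* x) := d :* e :* x) refl (ι d) (ι e) y)
            (cong (_* y) (sym (ι-* d e)))) (Mem-* (Mem-ι d) ey))

  private module QO = Order quadraticOrder

  conj-^ : ∀ a n → conj (a Q.^ n) ≡ conj a Q.^ n
  conj-^ a zero    = conj-embed 1#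
  conj-^ a (suc n) = trans (conj-* a (a Q.^ n)) (cong (conj a Q.*_) (conj-^ a n))

  opaque
    unfolding QO.AlmostIntegral

    AI-conj : ∀ {a} → QO.AlmostIntegral a → QO.AlmostIntegral (conj a)
    AI-conj {a} (d , d≢0 , da) = d , d≢0 , λ n →
      subst QO.Mem (trans (conj-* (Q.ι d) (a Q.^ n)) (cong₂ Q._*_ (conj-embed (ι d)) (conj-^ a n)))
        (Mem-+ (proj₁ (da n)) (Mem-* p∈O (proj₂ (da n))) , Mem-neg (proj₂ (da n)))

  embed-^ : ∀ x n → embed (x ^ n) ≡ embed x Q.^ n
  embed-^ x zero    = refl
  embed-^ x (suc n) = trans (embed-* x (x ^ n)) (cong (embed x Q.*_) (embed-^ x n))

  opaque
    unfolding QO.AlmostIntegral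

    AI-embed⁻¹ : ∀ {x} → QO.AlmostIntegral (embed x) → AlmostIntegral x
    AI-embed⁻¹ {x} (d , d≢0 , dx) = d , d≢0 , λ n →
      proj₁ (subst QO.Mem (trans (cong (Q.ι d Q.*_) (sym (embed-^ x n))) (sym (embed-* (ι d) (x ^ n))))
          (dx n))

  -- For a = x + y t we have (a − conj a)(2t − p) = y·disc and (a − conj a)² = y²·disc.
  quadraticOrder-closed : IntegrallyClosed → (∀ y → Mem (y * disc) → Mem (y * y * disc) → Mem y) →
                          QO.IntegrallyClosed
  quadraticOrder-closed closed descend {a@(x , y)} ai = x∈O , y∈O
    where
    diff : QO.AlmostIntegral (a Q.+ Q.- conj a)
    diff = QO.AI-+ ai (QO.AI-neg (AI-conj ai))
    y∈O : Mem y
    y∈O = descend y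
      (closed (AI-embed⁻¹ (subst QO.AlmostIntegral (cong₂ _,_
        (solve 4 (λ p q x y → (x :+ :- (x :+ p :* y)) :* :- p :+ q :* ((y :+ :- (:- y)) :* con (+ 2))
          := y :* (p :* p :+ con (+ 4) :* q)) refl p q x y)
        (solve 3 (λ p x y → (x :+ :- (x :+ p :* y)) :* con (+ 2) :+ (y :+ :- (:- y)) :* :- p
            :+ p :* ((y :+ :- (:- y)) :* con (+ 2))
          := con (+ 0)) refl p x y))
        (QO.AI-* {b = - p , ι (+ 2)} diff (QO.Mem⇒AI (Mem-neg p∈O , Mem-ι (+ 2)))))))
      (closed (AI-embed⁻¹ (subst QO.AlmostIntegral (cong₂ _,_
        (solve 4 (λ p q x y → (x :+ :- (x :+ p :* y)) :* (x :+ :- (x :+ p :* y))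
            :+ q :* ((y :+ :- (:- y)) :* (y :+ :- (:- y)))
          := y :* y :* (p :* p :+ con (+ 4) :* q)) refl p q x y)
        (solve 3 (λ p x y → (x :+ :- (x :+ p :* y)) :* (y :+ :- (:- y)) :+ (y :+ :- (:- y)) :*
          (x :+ :- (x :+ p :* y))
            :+ p :* ((y :+ :- (:- y)) :* (y :+ :- (:- y)))
          := con (+ 0)) refl p x y))
        (QO.AI-* diff diff))))
    x∈O : Mem x
    x∈O = closed (AI-embed⁻¹ (subst QO.AlmostIntegral
      (cong₂ _,_ (solve 1 (λ x → x :+ :- con (+ 0) := x) refl x) (-‿inverseʳ y))
      (QO.AI-+ {b = Q.- (0# , y)} ai (QO.AI-neg (QO.Mem⇒AI (Mem-ι (+ 0) , y∈O))))))

-- The rational numbers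

toℚᵘ-toQ : ∀ i → toℚᵘ (toQ i) ℚᵘ.≃ mkℚᵘ i 0
toℚᵘ-toQ i = ℚP.toℚᵘ-fromℚᵘ (mkℚᵘ i 0)

toQ-injective : ∀ {i j} → toQ i ≡ toQ j → i ≡ j
toQ-injective {i} {j} eq with ℚᵘP.≃-trans (ℚᵘP.≃-sym (toℚᵘ-toQ i))
    (ℚᵘP.≃-trans (ℚᵘP.≃-reflexive (cong toℚᵘ eq)) (toℚᵘ-toQ j))
... | *≡* e = trans (sym (ℤP.*-identityʳ i)) (trans e (ℤP.*-identityʳ j))

ℚ-algebra : ℤ-Algebra
ℚ-algebra = record
  { Carrier = ℚ ; _+_ = ℚ._+_ ; _*_ = ℚ._*_ ; -_ = ℚ.-_ ; ι = toQ
  ; isCommutativeRing = ℚP.+-*-isCommutativeRing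
  ; ι-+ = λ i j → ℚP.toℚᵘ-injective (begin
      toℚᵘ (toQ (i ℤ.+ j))                ≈⟨ toℚᵘ-toQ (i ℤ.+ j) ⟩
      mkℚᵘ (i ℤ.+ j) 0
        ≡⟨ cong₂ (λ k l → mkℚᵘ (k ℤ.+ l) 0) (ℤP.*-identityʳ i) (ℤP.*-identityʳ j) ⟨
      mkℚᵘ i 0 ℚᵘ.+ mkℚᵘ j 0              ≈⟨ ℚᵘP.+-cong (toℚᵘ-toQ i) (toℚᵘ-toQ j) ⟨
      toℚᵘ (toQ i) ℚᵘ.+ toℚᵘ (toQ j)      ≈⟨ ℚP.toℚᵘ-homo-+ (toQ i) (toQ j) ⟨
      toℚᵘ (toQ i ℚ.+ toQ j)              ∎)
  ; ι-* = λ i j → ℚP.toℚᵘ-injective (begin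
      toℚᵘ (toQ (i ℤ.* j))                ≈⟨ toℚᵘ-toQ (i ℤ.* j) ⟩
      mkℚᵘ i 0 ℚᵘ.* mkℚᵘ j 0              ≈⟨ ℚᵘP.*-cong (toℚᵘ-toQ i) (toℚᵘ-toQ j) ⟨
      toℚᵘ (toQ i) ℚᵘ.* toℚᵘ (toQ j)      ≈⟨ ℚP.toℚᵘ-homo-* (toQ i) (toQ j) ⟨
      toℚᵘ (toQ i ℚ.* toQ j)              ∎)
  ; ι-neg = λ i → ℚP.toℚᵘ-injective (begin
      toℚᵘ (toQ (ℤ.- i))                  ≈⟨ toℚᵘ-toQ (ℤ.- i) ⟩
      ℚᵘ.- mkℚᵘ i 0                       ≈⟨ ℚᵘP.-‿cong (toℚᵘ-toQ i) ⟨
      ℚᵘ.- toℚᵘ (toQ i)                   ≈⟨ ℚP.toℚᵘ-homo‿- (toQ i) ⟨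
      toℚᵘ (ℚ.- toQ i)                    ∎)
  }
  where open ℚᵘP.≃-Reasoning

module ℚA = ℤ-Algebra ℚ-algebra

*-↧ : ∀ r → r ℚ.* toQ (↧ r) ≡ toQ (↥ r)
*-↧ r@(mkℚ n d-1 _) = ℚP.toℚᵘ-injective (begin
  toℚᵘ (r ℚ.* toQ (↧ r))                 ≈⟨ ℚP.toℚᵘ-homo-* r (toQ (↧ r)) ⟩
  mkℚᵘ n d-1 ℚᵘ.* toℚᵘ (toQ (↧ r))       ≈⟨ ℚᵘP.*-congˡ {mkℚᵘ n d-1} (toℚᵘ-toQ (↧ r)) ⟩
  mkℚᵘ n d-1 ℚᵘ.* mkℚᵘ (↧ r) 0
    ≈⟨ *≡* (trans (ℤP.*-identityʳ _) (cong (λ d → n ℤ.* + d) (sym (ℕP.*-identityʳ (suc d-1))))) ⟩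
  mkℚᵘ n 0                               ≈⟨ toℚᵘ-toQ n ⟨
  toℚᵘ (toQ n)                           ∎)
  where open ℚᵘP.≃-Reasoning

IsInt : ℚ → Set
IsInt r = Σ ℤ λ z → r ≡ toQ z

↧≡1⇒IsInt : ∀ r → ↧ₙ r ≡ 1 → IsInt r
↧≡1⇒IsInt r eq =
  ↥ r , trans (sym (ℚP.*-identityʳ r)) (trans (cong (λ d → r ℚ.* toQ (+ d)) (sym eq)) (*-↧ r))

IsInt-toQ : ∀ z → IsInt (toQ z)
IsInt-toQ z = z , refl

integers : Order ℚ-algebra
integers = record
  { Mem   = IsInt
  ; Mem-+ = λ (i , e) (j , f) → i ℤ.+ j , trans (cong₂ ℚ._+_ e f) (sym (ℚA.ι-+ i j))
  ; Mem-* = λ (i , e) (j , f) → i ℤ.* j , trans (cong₂ ℚ._*_ e f) (sym (ℚA.ι-* i j))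
  ; Mem-ι = IsInt-toQ
  ; clear = λ r → ↧ r , (λ ()) , ↥ r , trans (ℚP.*-comm (toQ (↧ r)) r) (*-↧ r)
  }

-- Denominators of rational numbers

coprime-*ʳ : ∀ {k m n} → Coprime k m → Coprime k n → Coprime k (m ℕ.* n)
coprime-*ʳ k⊥m k⊥n (d∣k , d∣mn) =
  k⊥n (d∣k , coprime-divisor (λ (e∣d , e∣m) → k⊥m (ℕD.∣-trans e∣d d∣k , e∣m)) d∣mn)

coprime-^ʳ : ∀ {k m} n → Coprime k m → Coprime k (m ℕ.^ n)
coprime-^ʳ {k} zero    k⊥m = Coprimality.sym (Coprimality.1-coprimeTo k)
coprime-^ʳ     (suc n) k⊥m = coprime-*ʳ k⊥m (coprime-^ʳ n k⊥m)

coprime-^ : ∀ {k m} n → Coprime k m → Coprime (k ℕ.^ n) (m ℕ.^ n)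
coprime-^ n k⊥m = coprime-^ʳ n (Coprimality.sym (coprime-^ʳ n (Coprimality.sym k⊥m)))

abs-^ : ∀ i n → ℤ.∣ i ℤ.^ n ∣ ≡ ℤ.∣ i ∣ ℕ.^ n
abs-^ i zero    = refl
abs-^ i (suc n) = trans (ℤP.abs-* i (i ℤ.^ n)) (cong (ℤ.∣ i ∣ ℕ.*_) (abs-^ i n))

toQ-^ : ∀ i n → toQ (i ℤ.^ n) ≡ toQ i ℚA.^ n
toQ-^ i zero    = refl
toQ-^ i (suc n) = trans (ℚA.ι-* i (i ℤ.^ n)) (cong (toQ i ℚ.*_) (toQ-^ i n))

coprime-↧↥ : ∀ r → Coprime (↧ₙ r) ℤ.∣ ↥ r ∣
coprime-↧↥ (mkℚ n d-1 c) = Coprimality.sym (Coprimality.recompute c)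

-- For r = a/m in lowest terms, integrality of d r^n means that m^n divides a^n d, and m^n is
-- coprime to a^n. Large n yields integral closedness, n = 2 the use of squarefreeness.
↧^∣ : ∀ d r n → IsInt (toQ d ℚ.* r ℚA.^ n) → ↧ₙ r ℕ.^ n ℕD.∣ ℤ.∣ d ∣
↧^∣ d r n (z , eq) = coprime-divisor (coprime-^ n (coprime-↧↥ r))
  (ℕD.divides ℤ.∣ z ∣ (begin
    ℤ.∣ ↥ r ∣ ℕ.^ n ℕ.* ℤ.∣ d ∣         ≡⟨ cong (ℕ._* ℤ.∣ d ∣) (abs-^ (↥ r) n) ⟨
    ℤ.∣ (↥ r) ℤ.^ n ∣ ℕ.* ℤ.∣ d ∣       ≡⟨ ℤP.abs-* ((↥ r) ℤ.^ n) d ⟨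
    ℤ.∣ (↥ r) ℤ.^ n ℤ.* d ∣
      ≡⟨ cong ℤ.∣_∣ (toQ-injective {(↥ r) ℤ.^ n ℤ.* d} {z ℤ.* (↧ r) ℤ.^ n} cross) ⟩
    ℤ.∣ z ℤ.* (↧ r) ℤ.^ n ∣             ≡⟨ ℤP.abs-* z ((↧ r) ℤ.^ n) ⟩
    ℤ.∣ z ∣ ℕ.* ℤ.∣ (↧ r) ℤ.^ n ∣       ≡⟨ cong (ℤ.∣ z ∣ ℕ.*_) (abs-^ (↧ r) n) ⟩
    ℤ.∣ z ∣ ℕ.* ↧ₙ r ℕ.^ n              ∎))
  where
  open ≡-Reasoning
  open ℚA.Solver
  cross : toQ ((↥ r) ℤ.^ n ℤ.* d) ≡ toQ (z ℤ.* (↧ r) ℤ.^ n)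
  cross = begin
    toQ ((↥ r) ℤ.^ n ℤ.* d)                          ≡⟨ ℚA.ι-* ((↥ r) ℤ.^ n) d ⟩
    toQ ((↥ r) ℤ.^ n) ℚ.* toQ d                      ≡⟨ cong (ℚ._* toQ d) (toQ-^ (↥ r) n) ⟩
    toQ (↥ r) ℚA.^ n ℚ.* toQ d                       ≡⟨ cong (λ x → x ℚA.^ n ℚ.* toQ d) (*-↧ r) ⟨
    (r ℚ.* toQ (↧ r)) ℚA.^ n ℚ.* toQ d               ≡⟨ cong (ℚ._* toQ d) (ℚA.^-distrib-* r (toQ (↧ r)) n) ⟩
    r ℚA.^ n ℚ.* toQ (↧ r) ℚA.^ n ℚ.* toQ d
      ≡⟨ solve 3 (λ x y d → x :* y :* d := d :* x :* y) refl (r ℚA.^ n) (toQ (↧ r) ℚA.^ n) (toQ d) ⟩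
    toQ d ℚ.* r ℚA.^ n ℚ.* toQ (↧ r) ℚA.^ n          ≡⟨ cong₂ ℚ._*_ eq (sym (toQ-^ (↧ r) n)) ⟩
    toQ z ℚ.* toQ ((↧ r) ℤ.^ n)                      ≡⟨ ℚA.ι-* z ((↧ r) ℤ.^ n) ⟨
    toQ (z ℤ.* (↧ r) ℤ.^ n)                          ∎

n<m^n : ∀ {m} → 1 ℕ.< m → ∀ n → n ℕ.< m ℕ.^ n
n<m^n 1<m zero = ℕ.s≤s ℕ.z≤n
n<m^n {m@(suc _)} 1<m (suc n) = ℕP.≤-<-trans (n<m^n 1<m n) (ℕP.^-monoʳ-< m 1<m (ℕP.n<1+n n))

opaque
  unfolding Order.AlmostIntegral

  -- A denominator m > 1 would satisfy that m^n divides d for every n. The exponent n = |d| is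
  -- already too large, since m^n > n.
  integers-closed : Order.IntegrallyClosed integers
  integers-closed {r} (d , d≢0 , dr) with ↧ₙ r ℕP.≟ 1
  ... | yes eq = ↧≡1⇒IsInt r eq
  ... | no ≢1 = ⊥-elim (ℕP.<⇒≱ (n<m^n (ℕP.≤∧≢⇒< (ℕ.s≤s ℕ.z≤n) (λ e → ≢1 (sym e))) ℤ.∣ d ∣)
      (ℕD.∣⇒≤ {{ℕ.≢-nonZero (λ e → d≢0 (ℤP.∣i∣≡0⇒i≡0 e))}} (↧^∣ d r ℤ.∣ d ∣ (dr ℤ.∣ d ∣))))

-- The square of the reduced denominator of r divides w, so squarefreeness is applied to that
-- denominator.
squarefree-clears : ∀ w → Squarefree w → ∀ r → IsInt (r ℚ.* r ℚ.* toQ w) → IsInt r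
squarefree-clears w sf r (z , eq) = ↧≡1⇒IsInt r (sf (↧ r)
  (subst (ℕD._∣ ℤ.∣ w ∣) (trans (cong (↧ₙ r ℕ.*_) (ℕP.*-identityʳ (↧ₙ r))) (sym (ℤP.abs-* (↧ r) (↧ r))))
    (↧^∣ w r 2 (z , trans
      (solve 2 (λ w r → w :* (r :* (r :* con (+ 1))) := r :* r :* w) refl (toQ w) r) eq))))
  where open ℚA.Solver

-- Opaque copies of the operations keep the conversion checker from unfolding the normalisation
-- of fractions inside towers over ℚ.
opaque
  infixl 6 _+ᵒ_
  infixl 7 _*ᵒ_
  infix 8 -ᵒ_

  _+ᵒ_ _*ᵒ_ : ℚ → ℚ → ℚ
  _+ᵒ_ = ℚ._+_
  _*ᵒ_ = ℚ._*_

  -ᵒ_ : ℚ → ℚ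
  -ᵒ_ = ℚ.-_

  +≡+ᵒ : ∀ a b → a ℚ.+ b ≡ a +ᵒ b
  +≡+ᵒ a b = refl

  *≡*ᵒ : ∀ a b → a ℚ.* b ≡ a *ᵒ b
  *≡*ᵒ a b = refl

  isCommutativeRingᵒ : IsCommutativeRing _≡_ _+ᵒ_ _*ᵒ_ -ᵒ_ (toQ (+ 0)) (toQ (+ 1))
  isCommutativeRingᵒ = ℚP.+-*-isCommutativeRing

  toQ-+ᵒ : ∀ i j → toQ (i ℤ.+ j) ≡ toQ i +ᵒ toQ j
  toQ-+ᵒ = ℚA.ι-+

  toQ-*ᵒ : ∀ i j → toQ (i ℤ.* j) ≡ toQ i *ᵒ toQ j
  toQ-*ᵒ = ℚA.ι-*

  toQ-negᵒ : ∀ i → toQ (ℤ.- i) ≡ -ᵒ toQ i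
  toQ-negᵒ = ℚA.ι-neg

ℚᵒ : ℤ-Algebra
ℚᵒ = record
  { Carrier = ℚ ; _+_ = _+ᵒ_ ; _*_ = _*ᵒ_ ; -_ = -ᵒ_ ; ι = toQ
  ; isCommutativeRing = isCommutativeRingᵒ ; ι-+ = toQ-+ᵒ ; ι-* = toQ-*ᵒ ; ι-neg = toQ-negᵒ }

opaque
  unfolding _+ᵒ_ isCommutativeRingᵒ

  integersᵒ-+ : ∀ {a b} → IsInt a → IsInt b → IsInt (a +ᵒ b)
  integersᵒ-+ = Order.Mem-+ integers

  integersᵒ-* : ∀ {a b} → IsInt a → IsInt b → IsInt (a *ᵒ b)
  integersᵒ-* = Order.Mem-* integers

  integersᵒ-clear : ∀ a → Σ ℤ λ d → ¬ (d ≡ + 0) × IsInt (toQ d *ᵒ a)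
  integersᵒ-clear = Order.clear integers

integersᵒ : Order ℚᵒ
integersᵒ = record
  { Mem = IsInt ; Mem-+ = integersᵒ-+ ; Mem-* = integersᵒ-* ; Mem-ι = IsInt-toQ ; clear = integersᵒ-clear }

opaque
  unfolding _+ᵒ_ isCommutativeRingᵒ Order.AlmostIntegral

  integersᵒ-closed : Order.IntegrallyClosed integersᵒ
  integersᵒ-closed = integers-closed

  squarefree-clearsᵒ : ∀ w → Squarefree w → ∀ r → IsInt (r *ᵒ r *ᵒ toQ w) → IsInt r
  squarefree-clearsᵒ = squarefree-clears

-- The quadratic tower

-- W₁ and W₂ are W s for s = −1 and s = 1.
W : ℤ → ℤ → ℤ → ℤ
W s A B = B ℤ.+ + 2 ℤ.+ + 2 ℤ.* s ℤ.* A

W₃ : ℤ → ℤ → ℤ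
W₃ A B = A ℤ.* A ℤ.- + 4 ℤ.* B ℤ.+ + 8

module Discriminants (R : ℤ-Algebra) (A B : ℤ) where
  open ℤ-Algebra R

  ι-W : ∀ s → ι (W s A B) ≡ ι B + ι (+ 2) + ι (+ 2) * ι s * ι A
  ι-W s = trans (ι-+ (B ℤ.+ + 2) (+ 2 ℤ.* s ℤ.* A))
    (cong₂ _+_ (ι-+ B (+ 2)) (trans (ι-* (+ 2 ℤ.* s) A) (cong (_* ι A) (ι-* (+ 2) s))))

  ι-W₃ : ι (W₃ A B) ≡ ι A * ι A + - (ι (+ 4) * ι B) + ι (+ 8)
  ι-W₃ = trans (ι-+ (A ℤ.* A ℤ.- + 4 ℤ.* B) (+ 8))
    (cong (_+ ι (+ 8)) (trans (ι-+ (A ℤ.* A) (ℤ.- (+ 4 ℤ.* B)))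
      (cong₂ _+_ (ι-* A A) (trans (ι-neg (+ 4 ℤ.* B)) (cong -_ (ι-* (+ 4) B))))))

-- η = θ + θ⁻¹ is a root of y² + A y + B − 2, and θ a root of x² − η x + 1.
module Tower (F : ℤ-Algebra) (A B : ℤ) where
  open ℤ-Algebra F
  p q : Carrier
  p = - ι A
  q = ι (+ 2) + - ι B

  module QE = Quadratic F p q
  module E = ℤ-Algebra QE.quadratic

  η : E.Carrier
  η = 0# , 1#

  module QK = Quadratic QE.quadratic η (E.- E.1#)
  module K = ℤ-Algebra QK.quadratic

  θ : K.Carrier
  θ = E.0# , E.1#

  κ : Carrier → K.Carrier
  κ r = QK.embed (QE.embed r)

  -- A copy of the tower arithmetic on solver polynomials, with a and b standing for `ι A` and
  -- `ι B`. It mirrors the operations of `E` and `K` term by term, so a coordinate of a tower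
  -- expression is the evaluation of its syntactic counterpart.
  module Syntax {n} (a b : Solver.Polynomial n) where
    open Solver

    Eˢ Kˢ : Set
    Eˢ = Polynomial n × Polynomial n
    Kˢ = Eˢ × Eˢ

    infixl 6 _+ᴱ_ _+ᴷ_
    infixl 7 _*ᴱ_ _*ᴷ_

    _+ᴱ_ _*ᴱ_ : Eˢ → Eˢ → Eˢ
    (x , y) +ᴱ (z , w) = x :+ z , y :+ w
    (x , y) *ᴱ (z , w) = x :* z :+ (con (+ 2) :+ :- b) :* (y :* w) , x :* w :+ y :* z :+ :- a :* (y :* w)

    ιᴱ : ℤ → Eˢ
    ιᴱ i = con i , con (+ 0)

    ηˢ -1ˢ : Eˢ
    ηˢ  = con (+ 0) , con (+ 1)
    -1ˢ = :- con (+ 1) , :- con (+ 0)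

    _+ᴷ_ _*ᴷ_ : Kˢ → Kˢ → Kˢ
    (x , y) +ᴷ (z , w) = x +ᴱ z , y +ᴱ w
    (x , y) *ᴷ (z , w) = x *ᴱ z +ᴱ -1ˢ *ᴱ (y *ᴱ w) , x *ᴱ w +ᴱ y *ᴱ z +ᴱ ηˢ *ᴱ (y *ᴱ w)

    infix 8 -ᴷ_
    -ᴷ_ : Kˢ → Kˢ
    -ᴷ ((x , y) , (z , w)) = (:- x , :- y) , (:- z , :- w)

    κˢ : Polynomial n → Kˢ
    κˢ r = (r , con (+ 0)) , ιᴱ (+ 0)

    θˢ : Kˢ
    θˢ = ιᴱ (+ 0) , ιᴱ (+ 1)

    discˢ : Eˢ
    discˢ = ηˢ *ᴱ ηˢ +ᴱ ιᴱ (+ 4) *ᴱ -1ˢ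

  -- Since θ² = η θ - 1, multiplication by θ sends u + v θ to -v + (u + η v) θ. This is one Horner
  -- step in the basis 1, η, θ, η θ.
  κ+θ* : ∀ r x y z w → κ r K.+ θ K.* ((x , y) , (z , w)) ≡ ((r + - z , - w) , (x + q * w , y + z + p * w))
  κ+θ* r x y z w = cong₂ _,_
    (cong₂ _,_
      (solve 7 (λ a b r x y z w → let open Syntax a b in
        proj₁ (proj₁ (κˢ r +ᴷ θˢ *ᴷ ((x , y) , (z , w)))) := r :+ :- z) refl (ι A) (ι B) r x y z w)
      (solve 7 (λ a b r x y z w → let open Syntax a b in
        proj₂ (proj₁ (κˢ r +ᴷ θˢ *ᴷ ((x , y) , (z , w)))) := :- w) refl (ι A) (ι B) r x y z w))
    (cong₂ _,_
      (solve 7 (λ a b r x y z w → let open Syntax a b in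
        proj₁ (proj₂ (κˢ r +ᴷ θˢ *ᴷ ((x , y) , (z , w))))
            := x :+ (con (+ 2) :+ :- b) :* w) refl (ι A) (ι B) r x y z w)
      (solve 7 (λ a b r x y z w → let open Syntax a b in
        proj₂ (proj₂ (κˢ r +ᴷ θˢ *ᴷ ((x , y) , (z , w))))
            := y :+ z :+ :- a :* w) refl (ι A) (ι B) r x y z w))
    where open Solver

  opaque
    unfolding K.cubic K.horner

    -- The change of basis from 1, θ, θ², θ³ to 1, η, θ, η θ: here θ² = -1 + η θ and θ³ = -η + (η² -
    -- 1) θ. Solved from r₃ downwards it is triangular with pivots ±1, which gives independence of
    -- the powers of θ over ℚ as well as equality of the two lattices over ℤ.
    cubic-coordinates : ∀ r₀ r₁ r₂ r₃ →
      K.cubic (κ r₀) (κ r₁) (κ r₂) (κ r₃) θ ≡ ((r₀ + - r₂ , - r₃) , (r₁ + - r₃ + q * r₃ , r₂ + p * r₃))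
    cubic-coordinates r₀ r₁ r₂ r₃ = begin
      K.cubic (κ r₀) (κ r₁) (κ r₂) (κ r₃) θ
        ≡⟨ cong (λ x → κ r₀ K.+ θ K.* (κ r₁ K.+ θ K.* (κ r₂ K.+ θ K.* x)))
            (trans (cong (κ r₃ K.+_) (K.zeroʳ θ)) (K.+-identityʳ (κ r₃))) ⟩
      κ r₀ K.+ θ K.* (κ r₁ K.+ θ K.* (κ r₂ K.+ θ K.* κ r₃))
        ≡⟨ cong (λ x → κ r₀ K.+ θ K.* (κ r₁ K.+ θ K.* x)) (κ+θ* r₂ r₃ 0# 0# 0#) ⟩
      κ r₀ K.+ θ K.* (κ r₁ K.+ θ K.* ((r₂ + - 0# , - 0#) , (r₃ + q * 0# , 0# + 0# + p * 0#)))
        ≡⟨ cong (λ x → κ r₀ K.+ θ K.* x) (trans (κ+θ* r₁ _ _ _ _) (cong₂ _,_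
             (cong₂ _,_
               (solve 3 (λ q r₁ r₃ → r₁ :+ :- (r₃ :+ q :* con (+ 0)) := r₁ :+ :- r₃) refl q r₁ r₃)
               (solve 1 (λ p → :- (con (+ 0) :+ con (+ 0) :+ p :* con (+ 0)) := con (+ 0)) refl p))
             (cong₂ _,_
               (solve 3 (λ p q r₂ → r₂ :+ :- con (+ 0) :+ q :* (con (+ 0) :+ con (+ 0) :+ p :* con (+ 0))
                   := r₂) refl p q r₂)
               (solve 3 (λ p q r₃ → :- con (+ 0) :+ (r₃ :+ q :* con (+ 0)) :+ p :*
                 (con (+ 0) :+ con (+ 0) :+ p :* con (+ 0))
                   := r₃) refl p q r₃)))) ⟩
      κ r₀ K.+ θ K.* ((r₁ + - r₃ , 0#) , (r₂ , r₃))
        ≡⟨ κ+θ* r₀ _ _ _ _ ⟩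
      ((r₀ + - r₂ , - r₃) , (r₁ + - r₃ + q * r₃ , 0# + r₂ + p * r₃))
        ≡⟨ cong (λ x → ((r₀ + - r₂ , - r₃) , (r₁ + - r₃ + q * r₃ , x + p * r₃))) (+-identityˡ r₂) ⟩
      ((r₀ + - r₂ , - r₃) , (r₁ + - r₃ + q * r₃ , r₂ + p * r₃)) ∎
      where
      open ≡-Reasoning
      open Solver

    θ-root : K.horner (F2 A B) θ ≡ K.0#
    θ-root = trans (cong (λ x → κ 1# K.+ θ K.* x)
        (trans horner≡cubic (cubic-coordinates (ι A) (ι B) (ι A) 1#)))
      (trans (κ+θ* 1# _ _ _ _) (cong₂ _,_
        (cong₂ _,_
          (solve 2 (λ a b → con (+ 1) :+ :- (b :+ :- con (+ 1) :+ (con (+ 2) :+ :- b) :* con (+ 1))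
              := con (+ 0)) refl (ι A) (ι B))
          (solve 2 (λ a b → :- (a :+ :- a :* con (+ 1)) := con (+ 0)) refl (ι A) (ι B)))
        (cong₂ _,_
          (solve 2 (λ a b → a :+ :- a :+ (con (+ 2) :+ :- b) :* (a :+ :- a :* con (+ 1))
              := con (+ 0)) refl (ι A) (ι B))
          (solve 2 (λ a b → :- con (+ 1) :+
            (b :+ :- con (+ 1) :+ (con (+ 2) :+ :- b) :* con (+ 1)) :+ :- a :* (a :+ :- a :* con (+ 1))
              := con (+ 0)) refl (ι A) (ι B)))))
      where
      open Solver
      horner≡cubic : K.horner (A ∷ B ∷ A ∷ []) θ ≡ K.cubic (κ (ι A)) (κ (ι B)) (κ (ι A)) (κ 1#) θ
      horner≡cubic = cong (λ x → K.ι A K.+ θ K.* (K.ι B K.+ θ K.* (K.ι A K.+ θ K.* x)))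
        (sym (trans (cong (λ x → K.1# K.+ x) (K.zeroʳ θ)) (K.+-identityʳ K.1#)))

  cubic-independent : ∀ r₀ r₁ r₂ r₃ → K.cubic (κ r₀) (κ r₁) (κ r₂) (κ r₃) θ ≡ K.0# →
                      r₀ ≡ 0# × r₁ ≡ 0# × r₂ ≡ 0# × r₃ ≡ 0#
  cubic-independent r₀ r₁ r₂ r₃ root = r₀≡0 , r₁≡0 , r₂≡0 , r₃≡0
    where
    open Solver
    coordinates = trans (sym (cubic-coordinates r₀ r₁ r₂ r₃)) root
    r₃≡0 : r₃ ≡ 0#
    r₃≡0 = trans (solve 1 (λ x → x := :- (:- x)) refl r₃)
      (trans (cong (λ x → - (proj₂ (proj₁ x))) coordinates) (sym (ι-neg (+ 0))))
    r₂≡0 : r₂ ≡ 0#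
    r₂≡0 = trans (solve 2 (λ p x → x := x :+ p :* con (+ 0)) refl p r₂)
      (trans (cong (λ x → r₂ + p * x) (sym r₃≡0)) (cong (λ x → proj₂ (proj₂ x)) coordinates))
    r₁≡0 : r₁ ≡ 0#
    r₁≡0 = trans (solve 2 (λ q x → x := x :+ :- con (+ 0) :+ q :* con (+ 0)) refl q r₁)
      (trans (cong (λ x → r₁ + - x + q * x) (sym r₃≡0)) (cong (λ x → proj₁ (proj₂ x)) coordinates))
    r₀≡0 : r₀ ≡ 0#
    r₀≡0 = trans (solve 1 (λ x → x := x :+ :- con (+ 0)) refl r₀)
      (trans (cong (λ x → r₀ + - x) (sym r₂≡0)) (cong (λ x → proj₁ (proj₁ x)) coordinates))

-- Matching on the sign makes s a numeral, so the solver can use s² = 1 by computation.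
data IsSign : ℤ → Set where
  plus  : IsSign (+ 1)
  minus : IsSign -[1+ 0 ]

-- Integral closedness from squarefree discriminants

module Closed (A B : ℤ) where
  open Tower ℚᵒ A B
  open ℤ-Algebra ℚᵒ
  open Order integersᵒ

  p∈ℤ : IsInt p
  p∈ℤ = Mem-neg (IsInt-toQ A)
  q∈ℤ : IsInt q
  q∈ℤ = Mem-- (IsInt-toQ (+ 2)) (IsInt-toQ B)

  module OE = QuadraticOrder integersᵒ p∈ℤ q∈ℤ
  ℤ[η] = OE.quadraticOrder
  module ℤη = Order ℤ[η]

  η∈ : ℤη.Mem η
  η∈ = IsInt-toQ (+ 0) , IsInt-toQ (+ 1)
  -1∈ : ℤη.Mem (E.- E.1#)
  -1∈ = ℤη.Mem-neg (ℤη.Mem-ι (+ 1))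

  module OK = QuadraticOrder ℤ[η] η∈ -1∈
  ℤ[θ] = OK.quadraticOrder

  open Discriminants ℚᵒ A B

  W₃≡disc : toQ (W₃ A B) ≡ QE.disc
  W₃≡disc = trans ι-W₃
    (solve 2 (λ a b → a :* a :+ :- (con (+ 4) :* b) :+ con (+ 8)
        := :- a :* :- a :+ con (+ 4) :* (con (+ 2) :+ :- b)) refl (toQ A) (toQ B))
    where open Solver

  ℤ[η]-closed : Squarefree (W₃ A B) → ℤη.IntegrallyClosed
  ℤ[η]-closed sf = OE.quadraticOrder-closed integersᵒ-closed λ y _ m →
    squarefree-clearsᵒ (W₃ A B) sf y (subst (λ d → IsInt (y * y * d)) (sym W₃≡disc) m)

  -- Let P(y) = y² + A y + B - 2, so P(2s) = W s. Dividing (v₀ + v₁ y)(y² - 4) by P leaves the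
  -- quotient v₁ y + v₀ - A v₁, with value v₀ + (2s - A) v₁ at y = 2s. The same shift appears when
  -- w(y)² - (y² - 4) n(y) is divided by P.
  2s-A : ℤ → ℚ
  2s-A s = toQ (+ 2) * toQ s + - toQ A

  -- For w = v (η² − 4) and n = v² (η² − 4), reducing modulo η − 2s turns w² = (η² − 4) n
  -- into W times this identity.
  W-identity : ∀ {s} → IsSign s → ∀ (v : E.Carrier) →
    let (v₀ , v₁) = v ; c = v₀ + 2s-A s * v₁ ; w = v E.* QK.disc ; n = v E.* v E.* QK.disc in
    proj₂ w * proj₂ w + - (proj₁ n + 2s-A s * proj₂ n) ≡ c * c * toQ (W s A B)
  W-identity {s} sign v@(v₀ , v₁) = trans (polynomial sign) (cong (c * c *_) (sym (ι-W s)))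
    where
    c = v₀ + 2s-A s * v₁
    open Solver
    equation : (s a b v₀ v₁ : Polynomial 4) → Polynomial 4 × Polynomial 4
    equation s a b v₀ v₁ =
      let open Syntax a b
          t = con (+ 2) :* s :+ :- a ; v = v₀ , v₁ ; w = v *ᴱ discˢ ; n = v *ᴱ v *ᴱ discˢ ; c = v₀ :+ t :* v₁ in
      proj₂ w :* proj₂ w :+ :- (proj₁ n :+ t :* proj₂ n)
          := c :* c :* (b :+ con (+ 2) :+ con (+ 2) :* s :* a)
    polynomial : ∀ {s} → IsSign s →
        let c = v₀ + 2s-A s * v₁ ; w = v E.* QK.disc ; n = v E.* v E.* QK.disc in
      proj₂ w * proj₂ w + - (proj₁ n + 2s-A s * proj₂ n) ≡ c * c *
          (toQ B + toQ (+ 2) + toQ (+ 2) * toQ s * toQ A)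
    polynomial plus  = solve 4 (equation (con (+ 1))) refl (toQ A) (toQ B) v₀ v₁
    polynomial minus = solve 4 (equation (con -[1+ 0 ])) refl (toQ A) (toQ B) v₀ v₁

  -- As 1 = (1 + 4k) - k · 4, the number r is a combination of the two given multiples. The number 1
  -- + 4k will be W₁ W₂.
  quarter : ∀ k r → IsInt (toQ (+ 4) * r) → IsInt (r * toQ (+ 1 ℤ.+ + 4 ℤ.* k)) → IsInt r
  quarter k r 4r rm = subst IsInt
    (trans (cong (λ m → r * m + - (toQ k * (toQ (+ 4) * r)))
      (trans (ι-+ (+ 1) (+ 4 ℤ.* k)) (cong (_+_ 1#) (ι-* (+ 4) k))))
      (solve 2 (λ r k → r :* (con (+ 1) :+ con (+ 4) :* k) :+ :- (k :* (con (+ 4) :* r))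
          := r) refl r (toQ k)))
    (Mem-- rm (Mem-* (IsInt-toQ k) 4r))
    where open Solver

  -- The norm of η² - 4 is P(2) P(-2) = W₁ W₂. Hence integrality of v (η² - 4) yields that of v W₁
  -- W₂, a multiple coprime to 4.
  norm-Δ : ∀ v → let w = toQ (W -[1+ 0 ] A B) * toQ (W (+ 1) A B) in
    (v E.* QK.disc) E.* QE.conj QK.disc ≡ (proj₁ v * w , proj₂ v * w)
  norm-Δ v@(v₀ , v₁) = begin
    (v E.* QK.disc) E.* QE.conj QK.disc        ≡⟨ E.*-assoc v QK.disc (QE.conj QK.disc) ⟩
    v E.* (QK.disc E.* QE.conj QK.disc)
      ≡⟨ cong (v E.*_) (trans (E.*-comm QK.disc (QE.conj QK.disc)) (QE.conj-norm QK.disc)) ⟩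
    v E.* QE.embed (QE.norm QK.disc)           ≡⟨ E.*-comm v (QE.embed (QE.norm QK.disc)) ⟩
    QE.embed (QE.norm QK.disc) E.* v           ≡⟨ QE.embed-scale (QE.norm QK.disc) v₀ v₁ ⟩
    (QE.norm QK.disc * v₀ , QE.norm QK.disc * v₁) ≡⟨ cong (λ n → (n * v₀ , n * v₁)) norm≡ ⟩
    (w * v₀ , w * v₁)                          ≡⟨ cong₂ _,_ (*-comm w v₀) (*-comm w v₁) ⟩
    (v₀ * w , v₁ * w)                          ∎
    where
    open ≡-Reasoning
    open Solver
    w = toQ (W -[1+ 0 ] A B) * toQ (W (+ 1) A B)
    norm≡ : QE.norm QK.disc ≡ w
    norm≡ = trans
      (solve 2 (λ a b → let open Syntax a b ; (x , y) = discˢ in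
          x :* x :+ :- a :* (x :* y) :+ :- (con (+ 2) :+ :- b) :* (y :* y)
          := (b :+ con (+ 2) :+ con (+ 2) :* con -[1+ 0 ] :* a) :*
              (b :+ con (+ 2) :+ con (+ 2) :* con (+ 1) :* a))
        refl (toQ A) (toQ B))
      (cong₂ _*_ (sym (ι-W -[1+ 0 ])) (sym (ι-W (+ 1))))

  -- Two multiples of v = v₀ + v₁ η are shown integral: 4 v, through the values c(1) and c(-1), and
  -- W₁ W₂ v, through the norm. Being coprime, they give v itself.
  ℤ[θ]-closed : ∀ k → W -[1+ 0 ] A B ℤ.* W (+ 1) A B ≡ + 1 ℤ.+ + 4 ℤ.* k →
                Squarefree (W -[1+ 0 ] A B) → Squarefree (W (+ 1) A B) → Squarefree (W₃ A B) →
                Order.IntegrallyClosed ℤ[θ]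
  ℤ[θ]-closed k W₁W₂≡1+4k sf₁ sf₂ sf₃ = OK.quadraticOrder-closed (ℤ[η]-closed sf₃) descend
    where
    open Solver
    descend : ∀ v → ℤη.Mem (v E.* QK.disc) → ℤη.Mem (v E.* v E.* QK.disc) → ℤη.Mem v
    descend v@(v₀ , v₁) w∈ n∈ =
      quarter k v₀ 4v₀ (component v₀ (proj₁ product∈)) , quarter k v₁ 4v₁ (component v₁ (proj₂ product∈))
      where
      c : ℤ → ℚ
      c s = v₀ + 2s-A s * v₁
      2s-A∈ : ∀ s → IsInt (2s-A s)
      2s-A∈ s = Mem-- (Mem-* (IsInt-toQ (+ 2)) (IsInt-toQ s)) (IsInt-toQ A)
      -- By `W-identity` the number W s · c(s)² is an integer, and a squarefree W s leaves c(s) no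
      -- denominator.
      c∈ : ∀ {s} → IsSign s → Squarefree (W s A B) → IsInt (c s)
      c∈ {s} sign sf = squarefree-clearsᵒ (W s A B) sf (c s) (subst IsInt (W-identity sign v)
        (Mem-- (Mem-* (proj₂ w∈) (proj₂ w∈)) (Mem-+ (proj₁ n∈) (Mem-* (2s-A∈ s) (proj₂ n∈)))))
      c₊ = c∈ plus sf₂
      -- The values c(1) and c(-1) are those of one linear polynomial with slope v₁ at 2 and -2,
      -- hence differ by 4 v₁.
      4v₁ : IsInt (toQ (+ 4) * v₁)
      4v₁ = subst IsInt
        (solve 3 (λ a x y → x :+ (con (+ 2) :* con (+ 1) :+ :- a) :* y :+ :-
          (x :+ (con (+ 2) :* con -[1+ 0 ] :+ :- a) :* y)
          := con (+ 4) :* y) refl (toQ A) v₀ v₁)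
        (Mem-- c₊ (c∈ minus sf₁))
      4v₀ : IsInt (toQ (+ 4) * v₀)
      4v₀ = subst IsInt
        (solve 3 (λ t x y → con (+ 4) :* (x :+ t :* y) :+ :- (t :* (con (+ 4) :* y)) := con (+ 4) :* x)
          refl (2s-A (+ 1)) v₀ v₁)
        (Mem-- (Mem-* (IsInt-toQ (+ 4)) c₊) (Mem-* (2s-A∈ (+ 1)) 4v₁))
      Δ∈ : ℤη.Mem QK.disc
      Δ∈ = ℤη.Mem-+ (ℤη.Mem-* η∈ η∈) (ℤη.Mem-* (ℤη.Mem-ι (+ 4)) -1∈)
      product∈ = subst ℤη.Mem (norm-Δ v)
        (ℤη.Mem-* {v E.* QK.disc} {QE.conj QK.disc} w∈
          (Mem-+ (proj₁ Δ∈) (Mem-* p∈ℤ (proj₂ Δ∈)) , Mem-neg (proj₂ Δ∈)))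
      component : ∀ r → IsInt (r * (toQ (W -[1+ 0 ] A B) * toQ (W (+ 1) A B))) →
          IsInt (r * toQ (+ 1 ℤ.+ + 4 ℤ.* k))
      component r =
        subst (λ m → IsInt (r * m)) (trans (sym (ι-* (W -[1+ 0 ] A B) (W (+ 1) A B))) (cong toQ W₁W₂≡1+4k))

-- Polynomials and the quotient by f

coeff-+ₚ : ∀ p q n → coeff (p +ₚ q) n ≡ coeff p n ℚ.+ coeff q n
coeff-+ₚ []      q       n       = sym (ℚP.+-identityˡ _)
coeff-+ₚ (a ∷ p) []      n       = sym (ℚP.+-identityʳ _)
coeff-+ₚ (a ∷ p) (b ∷ q) zero    = refl
coeff-+ₚ (a ∷ p) (b ∷ q) (suc n) = coeff-+ₚ p q n

coeff-scale : ∀ a q n → coeff (map (a ℚ.*_) q) n ≡ a ℚ.* coeff q n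
coeff-scale a []      n       = sym (ℚP.*-zeroʳ a)
coeff-scale a (b ∷ q) zero    = refl
coeff-scale a (b ∷ q) (suc n) = coeff-scale a q n

coeff-∷* : ∀ a p q n → coeff ((a ∷ p) *ₚ q) n ≡ a ℚ.* coeff q n ℚ.+ coeff (0ℚ ∷ (p *ₚ q)) n
coeff-∷* a p q n =
  trans (coeff-+ₚ (map (a ℚ.*_) q) (0ℚ ∷ (p *ₚ q)) n)
      (cong (ℚ._+ coeff (0ℚ ∷ (p *ₚ q)) n) (coeff-scale a q n))

neg≡-1* : ∀ c → ℚ.- c ≡ toQ -[1+ 0 ] ℚ.* c
neg≡-1* = solve 1 (λ c → :- c := con -[1+ 0 ] :* c) refl
  where open ℚA.Solver

module Evaluation (R : ℤ-Algebra) (κ : ℚ → ℤ-Algebra.Carrier R)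
  (κ-+ : ∀ a b → κ (a ℚ.+ b) ≡ ℤ-Algebra._+_ R (κ a) (κ b))
  (κ-* : ∀ a b → κ (a ℚ.* b) ≡ ℤ-Algebra._*_ R (κ a) (κ b))
  (κ-toQ : ∀ z → κ (toQ z) ≡ ℤ-Algebra.ι R z) where
  open ℤ-Algebra R
  open Solver

  opaque
    unfolding cubic horner

    eval : PolyQ → Carrier → Carrier
    eval []      x = 0#
    eval (c ∷ p) x = κ c + x * eval p x

    eval-+ₚ : ∀ p q x → eval (p +ₚ q) x ≡ eval p x + eval q x
    eval-+ₚ []      q       x = sym (+-identityˡ (eval q x))
    eval-+ₚ (a ∷ p) []      x = sym (+-identityʳ (eval (a ∷ p) x))
    eval-+ₚ (a ∷ p) (b ∷ q) x = trans (cong₂ (λ y z → y + x * z) (κ-+ a b) (eval-+ₚ p q x))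
      (solve 5 (λ a b x s t → a :+ b :+ x :* (s :+ t)
          := a :+ x :* s :+ (b :+ x :* t)) refl (κ a) (κ b) x (eval p x) (eval q x))

    eval-scale : ∀ a q x → eval (map (a ℚ.*_) q) x ≡ κ a * eval q x
    eval-scale a []      x = sym (zeroʳ _)
    eval-scale a (b ∷ q) x = trans (cong₂ (λ y z → y + x * z) (κ-* a b) (eval-scale a q x))
      (solve 4 (λ a b x s → a :* b :+ x :* (a :* s) := a :* (b :+ x :* s)) refl (κ a) (κ b) x (eval q x))

    eval-*ₚ : ∀ p q x → eval (p *ₚ q) x ≡ eval p x * eval q x
    eval-*ₚ []      q x = sym (zeroˡ _)
    eval-*ₚ (a ∷ p) q x = begin
      eval (map (a ℚ.*_) q +ₚ (0ℚ ∷ (p *ₚ q))) x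
        ≡⟨ eval-+ₚ (map (a ℚ.*_) q) (0ℚ ∷ (p *ₚ q)) x ⟩
      eval (map (a ℚ.*_) q) x + (κ 0ℚ + x * eval (p *ₚ q) x)
        ≡⟨ cong₂ _+_ (eval-scale a q x) (cong₂ (λ y z → y + x * z) (κ-toQ (+ 0)) (eval-*ₚ p q x)) ⟩
      κ a * eval q x + (0# + x * (eval p x * eval q x))
        ≡⟨ solve 4 (λ a x s t → a :* t :+ (con (+ 0) :+ x :* (s :* t))
            := (a :+ x :* s) :* t) refl (κ a) x (eval p x) (eval q x) ⟩
      (κ a + x * eval p x) * eval q x                             ∎
      where open ≡-Reasoning

    eval-≈[] : ∀ p x → p ≈ₚ [] → eval p x ≡ 0#
    eval-≈[] []      x p≈ = refl
    eval-≈[] (a ∷ p) x p≈ = trans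
      (cong₂ (λ y z → y + x * z) (trans (cong κ (p≈ 0)) (κ-toQ (+ 0))) (eval-≈[] p x (λ n → p≈ (suc n))))
      (trans (cong (λ y → 0# + y) (zeroʳ x)) (+-identityˡ 0#))

    eval-≈ₚ : ∀ p q x → p ≈ₚ q → eval p x ≡ eval q x
    eval-≈ₚ []      q       x p≈q = sym (eval-≈[] q x (λ n → sym (p≈q n)))
    eval-≈ₚ (a ∷ p) []      x p≈q = eval-≈[] (a ∷ p) x p≈q
    eval-≈ₚ (a ∷ p) (b ∷ q) x p≈q =
      cong₂ (λ y z → κ y + x * z) (p≈q 0) (eval-≈ₚ p q x (λ n → p≈q (suc n)))

    eval-constant : ∀ c x → eval [ c ] x ≡ κ c
    eval-constant c x = trans (cong (λ y → κ c + y) (zeroʳ x)) (+-identityʳ (κ c))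

    eval-evalAt : ∀ p α x → eval (evalAt p α) x ≡ eval p (eval α x)
    eval-evalAt []      α x = refl
    eval-evalAt (c ∷ p) α x = trans (eval-+ₚ [ c ] (α *ₚ evalAt p α) x)
      (cong₂ _+_ (eval-constant c x)
        (trans (eval-*ₚ α (evalAt p α) x) (cong (eval α x *_) (eval-evalAt p α x))))

    eval--ₚ : ∀ p q x → eval (p -ₚ q) x ≡ eval p x + - eval q x
    eval--ₚ p q x = trans (eval-+ₚ p (-ₚ q) x) (cong (λ y → eval p x + y) (eval-neg q))
      where
      eval-neg : ∀ q → eval (-ₚ q) x ≡ - eval q x
      eval-neg []      = ι-neg (+ 0)
      eval-neg (c ∷ q) = trans (cong₂ (λ y z → y + x * z)
          (begin
            κ (ℚ.- c)                    ≡⟨ cong κ (neg≡-1* c) ⟩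
            κ (toQ -[1+ 0 ] ℚ.* c)       ≡⟨ κ-* (toQ -[1+ 0 ]) c ⟩
            κ (toQ -[1+ 0 ]) * κ c       ≡⟨ cong (_* κ c) (κ-toQ -[1+ 0 ]) ⟩
            ι -[1+ 0 ] * κ c             ∎)
          (eval-neg q))
        (solve 3 (λ c x s → con -[1+ 0 ] :* c :+ x :* :- s := :- (c :+ x :* s)) refl (κ c) x (eval q x))
        where open ≡-Reasoning

    eval-cubic : ∀ r₀ r₁ r₂ r₃ x → eval (r₀ ∷ r₁ ∷ r₂ ∷ r₃ ∷ []) x ≡ cubic (κ r₀) (κ r₁) (κ r₂) (κ r₃) x
    eval-cubic r₀ r₁ r₂ r₃ x = refl

    eval-monic : ∀ cs x → eval (monic cs) x ≡ horner cs x
    eval-monic []       x = trans (eval-constant 1ℚ x) (κ-toQ (+ 1))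
    eval-monic (c ∷ cs) x = cong₂ (λ y z → y + x * z) (κ-toQ c) (eval-monic cs x)

    eval-intPoly∈ : ∀ (O : Order R) cs {x} → Order.Mem O x → Order.Mem O (eval (intPoly cs) x)
    eval-intPoly∈ O []       x∈ = Order.Mem-ι O (+ 0)
    eval-intPoly∈ O (c ∷ cs) x∈ =
      Mem-+ (subst Mem (sym (κ-toQ c)) (Mem-ι c)) (Mem-* x∈ (eval-intPoly∈ O cs x∈))
      where open Order O

module Quartic (A B : ℤ) where
  open Tower ℚᵒ A B public
  open Closed A B public using (ℤ[θ])
  open ℤ-Algebra ℚᵒ
  module ℤη = Order (Closed.ℤ[η] A B)
  module ℤθ = Order ℤ[θ]

  -- Polynomials compute with the transparent operations of ℚ and the tower with their opaque
  -- copies. The map `κ` is where the two meet.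
  κ-+ : ∀ a b → κ (a ℚ.+ b) ≡ κ a K.+ κ b
  κ-+ a b = trans (cong κ (+≡+ᵒ a b))
    (trans (cong QK.embed (QE.embed-+ a b)) (QK.embed-+ (QE.embed a) (QE.embed b)))

  κ-* : ∀ a b → κ (a ℚ.* b) ≡ κ a K.* κ b
  κ-* a b = trans (cong κ (*≡*ᵒ a b))
    (trans (cong QK.embed (QE.embed-* a b)) (QK.embed-* (QE.embed a) (QE.embed b)))

  κ-toQ : ∀ z → κ (toQ z) ≡ K.ι z
  κ-toQ z = refl

  open Evaluation QK.quadratic κ κ-+ κ-* κ-toQ public

  f : PolyQ
  f = monic (F2 A B)

  division : ∀ p → Σ PolyQ λ q → Σ ℚ λ r₀ → Σ ℚ λ r₁ → Σ ℚ λ r₂ → Σ ℚ λ r₃ →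
             p ≈ₚ ((q *ₚ f) +ₚ (r₀ ∷ r₁ ∷ r₂ ∷ r₃ ∷ []))
  division [] = [] , 0ℚ , 0ℚ , 0ℚ , 0ℚ , λ
    { 0 → refl ; 1 → refl ; 2 → refl ; 3 → refl ; (suc (suc (suc (suc n)))) → refl }
  division (c ∷ p) with division p
  ... | q , r₀ , r₁ , r₂ , r₃ , p≈ =
    -- Multiplying the old remainder by x creates r₃ x⁴. Trading it for r₃ f puts r₃ into the
    -- quotient and subtracts r₃ (1 + A x + B x² + A x³).
    r₃ ∷ q , c ℚ.- r₃ , r₀ ℚ.- r₃ ℚ.* toQ A , r₁ ℚ.- r₃ ℚ.* toQ B , r₂ ℚ.- r₃ ℚ.* toQ A , step
    where
    open ℚA.Solver
    rest = (r₀ ∷ r₁ ∷ r₂ ∷ r₃ ∷ [])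
    rest′ = (c ℚ.- r₃ ∷ r₀ ℚ.- r₃ ℚ.* toQ A ∷ r₁ ℚ.- r₃ ℚ.* toQ B ∷ r₂ ℚ.- r₃ ℚ.* toQ A ∷ [])
    shift : ∀ n → coeff p n ≡ coeff (q *ₚ f) n ℚ.+ coeff rest n
    shift n = trans (p≈ n) (coeff-+ₚ (q *ₚ f) rest n)
    expand : ∀ n → coeff (((r₃ ∷ q) *ₚ f) +ₚ rest′) n ≡ r₃ ℚ.* coeff f n ℚ.+ coeff
        (0ℚ ∷ (q *ₚ f)) n ℚ.+ coeff rest′ n
    expand n = trans (coeff-+ₚ ((r₃ ∷ q) *ₚ f) rest′ n) (cong (ℚ._+ coeff rest′ n) (coeff-∷* r₃ q f n))
    carry : ∀ r t x → x ℚ.+ r ≡ r₃ ℚ.* t ℚ.+ x ℚ.+ (r ℚ.- r₃ ℚ.* t)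
    carry r t x = solve 4 (λ r s t x → x :+ r := s :* t :+ x :+ (r :+ :- (s :* t))) refl r r₃ t x
    step : (c ∷ p) ≈ₚ (((r₃ ∷ q) *ₚ f) +ₚ rest′)
    step 0 = trans (solve 2 (λ c r → c
        := r :* con (+ 1) :+ con (+ 0) :+ (c :+ :- r)) refl c r₃) (sym (expand 0))
    step 1 = trans (shift 0) (trans (carry r₀ (toQ A) (coeff (q *ₚ f) 0)) (sym (expand 1)))
    step 2 = trans (shift 1) (trans (carry r₁ (toQ B) (coeff (q *ₚ f) 1)) (sym (expand 2)))
    step 3 = trans (shift 2) (trans (carry r₂ (toQ A) (coeff (q *ₚ f) 2)) (sym (expand 3)))
    step 4 = trans (shift 3) (trans
      (solve 2 (λ r x → x :+ r
          := r :* con (+ 1) :+ x :+ con (+ 0)) refl r₃ (coeff (q *ₚ f) 3)) (sym (expand 4)))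
    step (suc (suc (suc (suc (suc n))))) = trans (shift (4 ℕ.+ n)) (trans
      (solve 2 (λ r x → x :+ con (+ 0)
          := r :* con (+ 0) :+ x :+ con (+ 0)) refl r₃ (coeff (q *ₚ f) (4 ℕ.+ n)))
      (sym (expand (5 ℕ.+ n))))

  eval-f : eval f θ ≡ K.0#
  eval-f = trans (eval-monic (F2 A B) θ) θ-root

  eval-multiple : ∀ {p} → f ∣ₚ p → eval p θ ≡ K.0#
  eval-multiple {p} (q , qf≈p) = trans (sym (eval-≈ₚ (q *ₚ f) p θ qf≈p))
    (trans (eval-*ₚ q f θ) (trans (cong (eval q θ K.*_) eval-f) (K.zeroʳ (eval q θ))))

  root⇒remainder≡0 : ∀ p q r₀ r₁ r₂ r₃ → p ≈ₚ ((q *ₚ f) +ₚ (r₀ ∷ r₁ ∷ r₂ ∷ r₃ ∷ [])) → eval p θ ≡ K.0# →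
      (q *ₚ f) ≈ₚ p
  root⇒remainder≡0 p q r₀ r₁ r₂ r₃ p≈ root n = begin
      coeff (q *ₚ f) n                        ≡⟨ ℚP.+-identityʳ (coeff (q *ₚ f) n) ⟨
      coeff (q *ₚ f) n ℚ.+ 0ℚ                 ≡⟨ cong (coeff (q *ₚ f) n ℚ.+_) (remainder n) ⟨
      coeff (q *ₚ f) n ℚ.+ coeff r n          ≡⟨ coeff-+ₚ (q *ₚ f) r n ⟨
      coeff ((q *ₚ f) +ₚ r) n                 ≡⟨ p≈ n ⟨
      coeff p n                               ∎
    where
    open ≡-Reasoning
    r = r₀ ∷ r₁ ∷ r₂ ∷ r₃ ∷ []
    vanishing = cubic-independent r₀ r₁ r₂ r₃ (begin
      K.cubic (κ r₀) (κ r₁) (κ r₂) (κ r₃) θ  ≡⟨ eval-cubic r₀ r₁ r₂ r₃ θ ⟨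
      eval r θ                               ≡⟨ K.+-identityˡ (eval r θ) ⟨
      K.0# K.+ eval r θ                      ≡⟨ cong (K._+ eval r θ) (eval-multiple (q , λ _ → refl)) ⟨
      eval (q *ₚ f) θ K.+ eval r θ           ≡⟨ eval-+ₚ (q *ₚ f) r θ ⟨
      eval ((q *ₚ f) +ₚ r) θ                 ≡⟨ eval-≈ₚ p ((q *ₚ f) +ₚ r) θ p≈ ⟨
      eval p θ                               ≡⟨ root ⟩
      K.0#                                   ∎)
    remainder : ∀ n → coeff r n ≡ 0ℚ
    remainder 0 = proj₁ vanishing
    remainder 1 = proj₁ (proj₂ vanishing)
    remainder 2 = proj₁ (proj₂ (proj₂ vanishing))
    remainder 3 = proj₂ (proj₂ (proj₂ vanishing))
    remainder (suc (suc (suc (suc n)))) = refl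

  -- The remainder modulo f is a polynomial of degree at most 3 vanishing at θ, and 1, θ, θ², θ³ are
  -- independent. With `representative` this identifies K with ℚ[x]/(f), so the divisibilities in
  -- `Monogenic` become equations in K.
  kernel : ∀ p → eval p θ ≡ K.0# → f ∣ₚ p
  kernel p root = let q , r₀ , r₁ , r₂ , r₃ , p≈ = division p in q , root⇒remainder≡0 p q r₀ r₁ r₂ r₃ p≈ root

  -- `cubic-coordinates` is inverted by back-substitution starting at r₃. Its pivots are ±1, so
  -- integral coordinates give integral coefficients.
  representative : ∀ a → Σ PolyQ λ α → eval α θ ≡ a × (ℤθ.Mem a → Σ (List ℤ) λ β → intPoly β ≡ α)
  representative a@((x , y) , (z , w)) = r₀ ∷ r₁ ∷ r₂ ∷ r₃ ∷ [] , evaluates , integral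
    where
    open Solver
    r₃ = - y
    r₂ = w + - (p * r₃)
    r₁ = z + r₃ + - (q * r₃)
    r₀ = x + r₂
    evaluates : eval (r₀ ∷ r₁ ∷ r₂ ∷ r₃ ∷ []) θ ≡ a
    evaluates = trans (eval-cubic r₀ r₁ r₂ r₃ θ) (trans (cubic-coordinates r₀ r₁ r₂ r₃) (cong₂ _,_
      (cong₂ _,_
        (solve 2 (λ x r → x :+ r :+ :- r := x) refl x r₂)
        (solve 1 (λ y → :- (:- y) := y) refl y))
      (cong₂ _,_
        (solve 3 (λ q z r → z :+ r :+ :- (q :* r) :+ :- r :+ q :* r := z) refl q z r₃)
        (solve 3 (λ p w r → w :+ :- (p :* r) :+ p :* r := w) refl p w r₃))))
    integral : ℤθ.Mem a → Σ (List ℤ) λ β → intPoly β ≡ r₀ ∷ r₁ ∷ r₂ ∷ r₃ ∷ []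
    integral ((x∈ , y∈) , (z∈ , w∈)) = proj₁ i₀ ∷ proj₁ i₁ ∷ proj₁ i₂ ∷ proj₁ i₃ ∷ [] ,
      cong₂ _∷_ (sym (proj₂ i₀))
          (cong₂ _∷_ (sym (proj₂ i₁)) (cong₂ _∷_ (sym (proj₂ i₂)) (cong₂ _∷_ (sym (proj₂ i₃)) refl)))
      where
      open Order integersᵒ
      i₃ : IsInt r₃
      i₃ = Mem-neg y∈
      i₂ : IsInt r₂
      i₂ = Mem-- w∈ (Mem-* (Closed.p∈ℤ A B) i₃)
      i₁ : IsInt r₁
      i₁ = Mem-- (Mem-+ z∈ i₃) (Mem-* (Closed.q∈ℤ A B) i₃)
      i₀ : IsInt r₀
      i₀ = Mem-+ x∈ i₂

  evalAt-root⇒horner : ∀ α g → f ∣ₚ evalAt (monic g) α → K.horner g (eval α θ) ≡ K.0#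
  evalAt-root⇒horner α g f∣ = begin
    K.horner g (eval α θ)         ≡⟨ eval-monic g (eval α θ) ⟨
    eval (monic g) (eval α θ)     ≡⟨ eval-evalAt (monic g) α θ ⟨
    eval (evalAt (monic g) α) θ   ≡⟨ eval-multiple f∣ ⟩
    K.0#                          ∎
    where open ≡-Reasoning

  horner⇒evalAt-root : ∀ α g → K.horner g (eval α θ) ≡ K.0# → f ∣ₚ evalAt (monic g) α
  horner⇒evalAt-root α g root = kernel (evalAt (monic g) α)
    (trans (eval-evalAt (monic g) α θ) (trans (eval-monic g (eval α θ)) root))

  ∣-difference : ∀ α γ → eval α θ ≡ eval γ θ → f ∣ₚ (α -ₚ γ)
  ∣-difference α γ eq = kernel (α -ₚ γ) (begin
    eval (α -ₚ γ) θ                 ≡⟨ eval--ₚ α γ θ ⟩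
    eval α θ K.+ K.- eval γ θ       ≡⟨ cong (λ x → x K.+ K.- eval γ θ) eq ⟩
    eval γ θ K.+ K.- eval γ θ       ≡⟨ K.-‿inverseʳ (eval γ θ) ⟩
    K.0#                            ∎)
    where open ≡-Reasoning

  difference-∣ : ∀ α γ → f ∣ₚ (α -ₚ γ) → eval γ θ ≡ eval α θ
  difference-∣ α γ f∣ = begin
    b                                ≡⟨ K.+-identityˡ b ⟨
    K.0# K.+ b                       ≡⟨ cong (K._+ b) (eval-multiple f∣) ⟨
    eval (α -ₚ γ) θ K.+ b            ≡⟨ cong (K._+ b) (eval--ₚ α γ θ) ⟩
    eval α θ K.+ K.- b K.+ b         ≡⟨ K.+-assoc (eval α θ) (K.- b) b ⟩
    eval α θ K.+ (K.- b K.+ b)       ≡⟨ cong (λ x → eval α θ K.+ x) (K.-‿inverseˡ b) ⟩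
    eval α θ K.+ K.0#                ≡⟨ K.+-identityʳ (eval α θ) ⟩
    eval α θ                         ∎
    where
    open ≡-Reasoning
    b = eval γ θ

  integral⇒intPoly : ∀ a → ℤθ.Mem a → Σ (List ℤ) λ β → eval (intPoly β) θ ≡ a
  integral⇒intPoly a a∈ =
    proj₁ β , trans (cong (λ p → eval p θ) (proj₂ β)) (proj₁ (proj₂ (representative a)))
    where β = proj₂ (proj₂ (representative a)) a∈

  closed⇒maximal : ℤθ.IntegrallyClosed → ∀ α → (Σ (List ℤ) λ g → f ∣ₚ evalAt (monic g) α) →
                   Σ (List ℤ) λ β → f ∣ₚ (α -ₚ intPoly β)
  closed⇒maximal closed α (g , f∣) = proj₁ β , ∣-difference α (intPoly (proj₁ β)) (sym (proj₂ β))
    where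
    β : Σ (List ℤ) λ β → eval (intPoly β) θ ≡ eval α θ
    β = integral⇒intPoly (eval α θ)
        (closed {eval α θ} (ℤθ.monicRoot⇒AI g {eval α θ} (evalAt-root⇒horner α g f∣)))

  -- The form in which monogenicity is tested: it is applied to explicit integral elements whose
  -- coordinates show a denominator d, forcing d to be a unit.
  monogenic⇒∈ : Monogenic (F2 A B) → ∀ g a → K.horner g a ≡ K.0# → ℤθ.Mem a
  monogenic⇒∈ (_ , maximal) g a root = subst ℤθ.Mem
    (trans (difference-∣ α (intPoly (proj₁ β)) (proj₂ β)) αθ≡a)
    (eval-intPoly∈ ℤ[θ] (proj₁ β) {θ} (ℤη.Mem-ι (+ 0) , ℤη.Mem-ι (+ 1)))
    where
    α = proj₁ (representative a)
    αθ≡a : eval α θ ≡ a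
    αθ≡a = proj₁ (proj₂ (representative a))
    β : Σ (List ℤ) λ β → f ∣ₚ (α -ₚ intPoly β)
    β = maximal α (g , horner⇒evalAt-root α g (trans (cong (K.horner g) αθ≡a) root))

-- Integral elements with denominators

-- The lower coefficients of (x² - u x)² + t c (x² - u x) + t² w.
biquadratic : (t u c w : ℤ) → List ℤ
biquadratic t u c w = t ℤ.* t ℤ.* w ∷ ℤ.- (t ℤ.* c ℤ.* u) ∷ u ℤ.* u ℤ.+ t ℤ.* c ∷ ℤ.- (+ 2 ℤ.* u) ∷ []

module SingularElements (R : ℤ-Algebra) (A B : ℤ) where
  open ℤ-Algebra R
  open Solver
  open Discriminants R A B
  open ≡-Reasoning

  opaque
    unfolding horner

    -- With b = α² − uα = t m the relation for m reads b² + t c b + t² w = 0.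
    biquadratic-root : ∀ t u c w {α m} → α * α ≡ ι u * α + ι t * m → m * m ≡ - (ι c * m) + - ι w →
                       horner (biquadratic t u c w) α ≡ 0#
    biquadratic-root t u c w {α} {m} αα mm = begin
      horner (biquadratic t u c w) α
        ≡⟨ cong₂ (λ x y → x + α * y) (trans (ι-* (t ℤ.* t) w) (cong (_* ι w) (ι-* t t)))
            (cong₂ (λ x y → x + α * y)
              (trans (ι-neg (t ℤ.* c ℤ.* u)) (cong -_ (trans (ι-* (t ℤ.* c) u) (cong (_* ι u) (ι-* t c)))))
              (cong₂ (λ x y → x + α * (y + α * 1#))
                (trans (ι-+ (u ℤ.* u) (t ℤ.* c)) (cong₂ _+_ (ι-* u u) (ι-* t c)))
                (trans (ι-neg (+ 2 ℤ.* u)) (cong -_ (ι-* (+ 2) u))))) ⟩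
      ι t * ι t * ι w + α *
          (- (ι t * ι c * ι u) + α * (ι u * ι u + ι t * ι c + α * (- (ι (+ 2) * ι u) + α * 1#)))
        ≡⟨ solve 5 (λ t u c w x → t :* t :* w :+ x :*
            (:- (t :* c :* u) :+ x :* (u :* u :+ t :* c :+ x :* (:- (con (+ 2) :* u) :+ x :* con (+ 1))))
             := (x :* x :+ :- (u :* x)) :* (x :* x :+ :- (u :* x)) :+ t :* c :*
                 (x :* x :+ :- (u :* x)) :+ t :* t :* w) refl (ι t) (ι u) (ι c) (ι w) α ⟩
      β α * β α + ι t * ι c * β α + ι t * ι t * ι w
        ≡⟨ cong (λ b → b * b + ι t * ι c * b + ι t * ι t * ι w) β≡ ⟩
      ι t * m * (ι t * m) + ι t * ι c * (ι t * m) + ι t * ι t * ι w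
        ≡⟨ solve 4 (λ t c w m → t :* m :* (t :* m) :+ t :* c :* (t :* m) :+ t :* t :* w
            := t :* t :* (m :* m :+ c :* m :+ w)) refl (ι t) (ι c) (ι w) m ⟩
      ι t * ι t * (m * m + ι c * m + ι w)
        ≡⟨ cong (λ x → ι t * ι t * (x + ι c * m + ι w)) mm ⟩
      ι t * ι t * (- (ι c * m) + - ι w + ι c * m + ι w)
        ≡⟨ solve 4 (λ t c w m → t :* t :* (:- (c :* m) :+ :- w :+ c :* m :+ w)
            := con (+ 0)) refl (ι t) (ι c) (ι w) m ⟩
      0# ∎
      where
      β : Carrier → Carrier
      β x = x * x + - (ι u * x)
      β≡ : β α ≡ ι t * m
      β≡ = trans (cong (λ x → x + - (ι u * α)) αα) (solve 3 (λ x y z → x :* z :+ y :+ :- (x :* z)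
          := y) refl (ι u) (ι t * m) α)

    squareRoot : ∀ k {α} → α * α ≡ ι k → horner (ℤ.- k ∷ + 0 ∷ []) α ≡ 0#
    squareRoot k {α} αα = begin
      ι (ℤ.- k) + α * (0# + α * 1#)      ≡⟨ cong (_+ α * (0# + α * 1#)) (ι-neg k) ⟩
      - ι k + α * (0# + α * 1#)
        ≡⟨ solve 2 (λ k x → :- k :+ x :* (con (+ 0) :+ x :* con (+ 1)) := x :* x :+ :- k) refl (ι k) α ⟩
      α * α + - ι k                      ≡⟨ cong (_+ - ι k) αα ⟩
      ι k + - ι k                        ≡⟨ -‿inverseʳ (ι k) ⟩
      0#                                 ∎

  module _ {θ η : Carrier} (θθ : θ * θ ≡ η * θ + - 1#) (ηη : η * η ≡ - ι A * η + (ι (+ 2) + - ι B)) where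

    -- The conjugate of η − 2s over ℚ, where (θ − s)² = θ (η − 2s).
    conjugate : ℤ → Carrier
    conjugate s = - ι A + - (ι (+ 2) * ι s) + - η

    -- Over K the polynomial P(y) = y² + A y + B - 2 factors as (y - η)(y - η′) with η′ = -A - η.
    -- The product is therefore P(2s), which is W s because s² = 1.
    conjugate-product : ∀ {s} → ι s * ι s ≡ 1# → (η + - (ι (+ 2) * ι s)) * conjugate s ≡ ι (W s A B)
    conjugate-product {s} ss = begin
      (η + - (ι (+ 2) * ι s)) * conjugate s
        ≡⟨ solve 3 (λ h a s → (h :+ :- (con (+ 2) :* s)) :* (:- a :+ :- (con (+ 2) :* s) :+ :- h)
             := :- (h :* h) :+ :- (a :* h) :+ con (+ 2) :* s :* a :+ con (+ 4) :* (s :* s))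
               refl η (ι A) (ι s) ⟩
      - (η * η) + - (ι A * η) + ι (+ 2) * ι s * ι A + ι (+ 4) * (ι s * ι s)
        ≡⟨ cong₂ (λ x y → - x + - (ι A * η) + ι (+ 2) * ι s * ι A + ι (+ 4) * y) ηη ss ⟩
      - (- ι A * η + (ι (+ 2) + - ι B)) + - (ι A * η) + ι (+ 2) * ι s * ι A + ι (+ 4) * 1#
        ≡⟨ solve 4 (λ h a b s → :- (:- a :* h :+ (con (+ 2) :+ :- b)) :+ :- (a :* h) :+ con
            (+ 2) :* s :* a :+ con (+ 4) :* con (+ 1)
             := b :+ con (+ 2) :+ con (+ 2) :* s :* a) refl η (ι A) (ι B) (ι s) ⟩
      ι B + ι (+ 2) + ι (+ 2) * ι s * ι A
        ≡⟨ ι-W s ⟨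
      ι (W s A B) ∎

    -- With e = 1/d and m the conjugate of η - 2s, the square is θ (η - 2s) m² / d² = θ m W / d² = k
    -- θ m, in which d has disappeared.
    singular : Carrier → ℤ → Carrier
    singular e s = e * ((θ + - ι s) * conjugate s)

    -- The square k θ m equals k (θ - s) m + k s m = k d α + k s m, whence u = k d and t = k s. The
    -- relation for m is P shifted by 2s, namely m² + (A + 4s) m + W = 0.
    singular-integral : ∀ s k d {e} → s ℤ.* s ≡ + 1 → ι d * e ≡ 1# → W s A B ≡ k ℤ.* (d ℤ.* d) →
      horner (biquadratic (k ℤ.* s) (k ℤ.* d) (A ℤ.+ + 4 ℤ.* s) (W s A B)) (singular e s) ≡ 0#
    singular-integral s k d {e} s*s≡1 de≡1 W≡ =
      biquadratic-root (k ℤ.* s) (k ℤ.* d) (A ℤ.+ + 4 ℤ.* s) (W s A B) αα mm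
      where
      m α : Carrier
      m = conjugate s
      α = singular e s
      ss : ι s * ι s ≡ 1#
      ss = trans (sym (ι-* s s)) (cong ι s*s≡1)
      ιW : ι (W s A B) ≡ ι k * (ι d * ι d)
      ιW = trans (cong ι W≡) (trans (ι-* k (d ℤ.* d)) (cong (ι k *_) (ι-* d d)))
      αα : α * α ≡ ι (k ℤ.* d) * α + ι (k ℤ.* s) * m
      αα = begin
        α * α
          ≡⟨ solve 4 (λ e t s m → e :* ((t :+ :- s) :* m) :* (e :* ((t :+ :- s) :* m))
               := e :* e :* m :* (m :* (t :* t :+ :- (con (+ 2) :* s :* t) :+ s :* s))) refl e θ (ι s) m ⟩
        e * e * m * (m * (θ * θ + - (ι (+ 2) * ι s * θ) + ι s * ι s))
          ≡⟨ cong₂ (λ x y → e * e * m * (m * (x + - (ι (+ 2) * ι s * θ) + y))) θθ ss ⟩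
        e * e * m * (m * (η * θ + - 1# + - (ι (+ 2) * ι s * θ) + 1#))
          ≡⟨ solve 5 (λ e h t s m → e :* e :* m :*
              (m :* (h :* t :+ :- con (+ 1) :+ :- (con (+ 2) :* s :* t) :+ con (+ 1)))
               := e :* e :* m :* t :* ((h :+ :- (con (+ 2) :* s)) :* m)) refl e η θ (ι s) m ⟩
        e * e * m * θ * ((η + - (ι (+ 2) * ι s)) * m)
          ≡⟨ cong (λ x → e * e * m * θ * x) (trans (conjugate-product {s} ss) ιW) ⟩
        e * e * m * θ * (ι k * (ι d * ι d))
          ≡⟨ solve 5 (λ e m t k d → e :* e :* m :* t :* (k :* (d :* d))
              := k :* (d :* e :* (d :* e)) :* t :* m) refl e m θ (ι k) (ι d) ⟩
        ι k * (ι d * e * (ι d * e)) * θ * m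
          ≡⟨ cong (λ x → ι k * (x * x) * θ * m) de≡1 ⟩
        ι k * (1# * 1#) * θ * m
          ≡⟨ solve 4 (λ k t m s → k :* (con (+ 1) :* con (+ 1)) :* t :* m
              := k :* con (+ 1) :* ((t :+ :- s) :* m) :+ k :* s :* m) refl (ι k) θ m (ι s) ⟩
        ι k * 1# * ((θ + - ι s) * m) + ι k * ι s * m
          ≡⟨ cong (λ x → ι k * x * ((θ + - ι s) * m) + ι k * ι s * m) de≡1 ⟨
        ι k * (ι d * e) * ((θ + - ι s) * m) + ι k * ι s * m
          ≡⟨ cong (_+ ι k * ι s * m) (solve 4 (λ k d e x → k :* (d :* e) :* x
              := k :* d :* (e :* x)) refl (ι k) (ι d) e ((θ + - ι s) * m)) ⟩
        ι k * ι d * α + ι k * ι s * m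
          ≡⟨ cong₂ (λ x y → x * α + y * m) (ι-* k d) (ι-* k s) ⟨
        ι (k ℤ.* d) * α + ι (k ℤ.* s) * m ∎
      mm : m * m ≡ - (ι (A ℤ.+ + 4 ℤ.* s) * m) + - ι (W s A B)
      mm = begin
        m * m
          ≡⟨ solve 3 (λ h a s → let m = :- a :+ :- (con (+ 2) :* s) :+ :- h in
               m :* m := :- ((a :+ con (+ 4) :* s) :* m) :+ :- ((h :+ :- (con (+ 2) :* s)) :* m))
                 refl η (ι A) (ι s) ⟩
        - ((ι A + ι (+ 4) * ι s) * m) + - ((η + - (ι (+ 2) * ι s)) * m)
          ≡⟨ cong₂ (λ x y → - (x * m) + - y) (sym (trans (ι-+ A (+ 4 ℤ.* s)) (cong₂ _+_
            refl (ι-* (+ 4) s)))) (conjugate-product {s} ss) ⟩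
        - (ι (A ℤ.+ + 4 ℤ.* s) * m) + - ι (W s A B) ∎

    -- By completing the square, 2η + A is a square root of W₃. Dividing by d leaves a square root
    -- of the cofactor k.
    singular₃ : Carrier → Carrier
    singular₃ e = e * (ι (+ 2) * η + ι A)

    singular₃-integral : ∀ k d {e} → ι d * e ≡ 1# → W₃ A B ≡ k ℤ.* (d ℤ.* d) →
      horner (ℤ.- k ∷ + 0 ∷ []) (singular₃ e) ≡ 0#
    singular₃-integral k d {e} de≡1 W≡ = squareRoot k (begin
      singular₃ e * singular₃ e
        ≡⟨ solve 3 (λ e h a → e :* (con (+ 2) :* h :+ a) :* (e :* (con (+ 2) :* h :+ a))
             := e :* e :* (con (+ 4) :* (h :* h) :+ con (+ 4) :* a :* h :+ a :* a)) refl e η (ι A) ⟩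
      e * e * (ι (+ 4) * (η * η) + ι (+ 4) * ι A * η + ι A * ι A)
        ≡⟨ cong (λ x → e * e * (ι (+ 4) * x + ι (+ 4) * ι A * η + ι A * ι A)) ηη ⟩
      e * e * (ι (+ 4) * (- ι A * η + (ι (+ 2) + - ι B)) + ι (+ 4) * ι A * η + ι A * ι A)
        ≡⟨ solve 4 (λ e h a b → e :* e :*
            (con (+ 4) :* (:- a :* h :+ (con (+ 2) :+ :- b)) :+ con (+ 4) :* a :* h :+ a :* a)
             := e :* e :* (a :* a :+ :- (con (+ 4) :* b) :+ con (+ 8))) refl e η (ι A) (ι B) ⟩
      e * e * (ι A * ι A + - (ι (+ 4) * ι B) + ι (+ 8))
        ≡⟨ cong (λ x → e * e * x)
            (trans (sym ι-W₃) (trans (cong ι W≡) (trans (ι-* k (d ℤ.* d)) (cong (ι k *_) (ι-* d d))))) ⟩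
      e * e * (ι k * (ι d * ι d))
        ≡⟨ solve 3 (λ e k d → e :* e :* (k :* (d :* d)) := k :* (d :* e :* (d :* e))) refl e (ι k) (ι d) ⟩
      ι k * (ι d * e * (ι d * e))
        ≡⟨ cong (λ x → ι k * (x * x)) de≡1 ⟩
      ι k * (1# * 1#)
        ≡⟨ solve 1 (λ k → k :* (con (+ 1) :* con (+ 1)) := k) refl (ι k) ⟩
      ι k ∎)

module TowerSingular (F : ℤ-Algebra) (A B : ℤ) where
  open Tower F A B
  open ℤ-Algebra F
  open SingularElements QK.quadratic A B

  ηᴷ : K.Carrier
  ηᴷ = QK.embed η

  θθ : θ K.* θ ≡ ηᴷ K.* θ K.+ K.- K.1#
  θθ = cong₂ _,_
    (cong₂ _,_
      (solve 2 (λ a b → let open Syntax a b in proj₁ (proj₁ (θˢ *ᴷ θˢ))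
          := proj₁ (proj₁ ((ηˢ , ιᴱ (+ 0)) *ᴷ θˢ +ᴷ -ᴷ κˢ (con (+ 1))))) refl (ι A) (ι B))
      (solve 2 (λ a b → let open Syntax a b in proj₂ (proj₁ (θˢ *ᴷ θˢ))
          := proj₂ (proj₁ ((ηˢ , ιᴱ (+ 0)) *ᴷ θˢ +ᴷ -ᴷ κˢ (con (+ 1))))) refl (ι A) (ι B)))
    (cong₂ _,_
      (solve 2 (λ a b → let open Syntax a b in proj₁ (proj₂ (θˢ *ᴷ θˢ))
          := proj₁ (proj₂ ((ηˢ , ιᴱ (+ 0)) *ᴷ θˢ +ᴷ -ᴷ κˢ (con (+ 1))))) refl (ι A) (ι B))
      (solve 2 (λ a b → let open Syntax a b in proj₂ (proj₂ (θˢ *ᴷ θˢ))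
          := proj₂ (proj₂ ((ηˢ , ιᴱ (+ 0)) *ᴷ θˢ +ᴷ -ᴷ κˢ (con (+ 1))))) refl (ι A) (ι B)))
    where open Solver

  ηη : ηᴷ K.* ηᴷ ≡ K.- K.ι A K.* ηᴷ K.+ (K.ι (+ 2) K.+ K.- K.ι B)
  ηη = cong₂ _,_
    (cong₂ _,_
      (solve 2 (λ a b → let open Syntax a b ; h = ηˢ , ιᴱ (+ 0) in
        proj₁ (proj₁ (h *ᴷ h))
            := proj₁ (proj₁ (-ᴷ κˢ a *ᴷ h +ᴷ (κˢ (con (+ 2)) +ᴷ -ᴷ κˢ b)))) refl (ι A) (ι B))
      (solve 2 (λ a b → let open Syntax a b ; h = ηˢ , ιᴱ (+ 0) in
        proj₂ (proj₁ (h *ᴷ h))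
            := proj₂ (proj₁ (-ᴷ κˢ a *ᴷ h +ᴷ (κˢ (con (+ 2)) +ᴷ -ᴷ κˢ b)))) refl (ι A) (ι B)))
    (cong₂ _,_
      (solve 2 (λ a b → let open Syntax a b ; h = ηˢ , ιᴱ (+ 0) in
        proj₁ (proj₂ (h *ᴷ h))
            := proj₁ (proj₂ (-ᴷ κˢ a *ᴷ h +ᴷ (κˢ (con (+ 2)) +ᴷ -ᴷ κˢ b)))) refl (ι A) (ι B))
      (solve 2 (λ a b → let open Syntax a b ; h = ηˢ , ιᴱ (+ 0) in
        proj₂ (proj₂ (h *ᴷ h))
            := proj₂ (proj₂ (-ᴷ κˢ a *ᴷ h +ᴷ (κˢ (con (+ 2)) +ᴷ -ᴷ κˢ b)))) refl (ι A) (ι B)))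
    where open Solver

  -- The coefficient of η θ shows the whole denominator: among the terms of (θ - s)(-A - 2s - η),
  -- only -θ η contributes to it.
  singular-coordinate : ∀ e s → proj₂ (proj₂ (singular θθ ηη (κ e) s)) ≡ - e
  singular-coordinate e s = solve 4 (λ a b e s → let open Syntax a b in
      proj₂ (proj₂ (κˢ e *ᴷ
          ((θˢ +ᴷ -ᴷ κˢ s) *ᴷ (-ᴷ κˢ a +ᴷ -ᴷ (κˢ (con (+ 2)) *ᴷ κˢ s) +ᴷ -ᴷ (ηˢ , ιᴱ (+ 0))))))
      := :- e) refl (ι A) (ι B) e (ι s)
    where open Solver

  singular₃-coordinate : ∀ e → proj₂ (proj₁ (singular₃ θθ ηη (κ e))) ≡ ι (+ 2) * e
  singular₃-coordinate e = solve 3 (λ a b e → let open Syntax a b in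
      proj₂ (proj₁ (κˢ e *ᴷ (κˢ (con (+ 2)) *ᴷ (ηˢ , ιᴱ (+ 0)) +ᴷ κˢ a)))
          := con (+ 2) :* e) refl (ι A) (ι B) e
    where open Solver

  κ-unit : ∀ d {e} → ι d * e ≡ 1# → K.ι d K.* κ e ≡ K.1#
  κ-unit d {e} de≡1 =
    trans (sym (trans (cong QK.embed (QE.embed-* (ι d) e)) (QK.embed-* (QE.embed (ι d)) (QE.embed e))))
        (cong κ de≡1)

reciprocal : ∀ d → ¬ d ≡ + 0 → Σ ℚ λ e → toQ d *ᵒ e ≡ 1ℚ
reciprocal d d≢0 = ℚ.1/ toQ d , trans (sym (*≡*ᵒ (toQ d) (ℚ.1/ toQ d))) (ℚP.*-inverseʳ (toQ d))
  where instance
    toQ-d≢0 : ℚ.NonZero (toQ d)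
    toQ-d≢0 = ℚ.≢-nonZero (λ eq → d≢0 (toQ-injective {d} {+ 0} eq))

IsInt-reciprocal : ∀ d {e} → toQ d *ᵒ e ≡ 1ℚ → IsInt e → ℤ.∣ d ∣ ≡ 1
IsInt-reciprocal d de≡1 (z , e≡z) = ℕP.m*n≡1⇒m≡1 ℤ.∣ d ∣ ℤ.∣ z ∣ (trans (sym (ℤP.abs-* d z))
  (cong ℤ.∣_∣ (toQ-injective {d ℤ.* z} {+ 1}
    (trans (toQ-*ᵒ d z) (trans (cong (toQ d *ᵒ_) (sym e≡z)) de≡1)))))

odd≢0 : ∀ j → ¬ (+ 1 ℤ.+ + 2 ℤ.* j) ≡ + 0
odd≢0 j eq =
  ℕP.1+n≢0 {0} (ℕP.suc-injective {1} {0} (ℕD.∣1⇒≡1 (Signed.∣⇒∣ᵤ {+ 2} {+ 1} (Signed.divides (ℤ.- j) (begin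
    + 1                                       ≡⟨ ℤP.+-identityʳ (+ 1) ⟨
    + 1 ℤ.+ + 0                               ≡⟨ cong (λ x → + 1 ℤ.+ x) (ℤP.+-inverseʳ (+ 2 ℤ.* j)) ⟨
    + 1 ℤ.+ (+ 2 ℤ.* j ℤ.+ ℤ.- (+ 2 ℤ.* j))   ≡⟨ ℤP.+-assoc (+ 1) (+ 2 ℤ.* j) (ℤ.- (+ 2 ℤ.* j)) ⟨
    + 1 ℤ.+ + 2 ℤ.* j ℤ.+ ℤ.- (+ 2 ℤ.* j)     ≡⟨ cong (ℤ._+ ℤ.- (+ 2 ℤ.* j)) eq ⟩
    + 0 ℤ.+ ℤ.- (+ 2 ℤ.* j)                   ≡⟨ ℤP.+-identityˡ (ℤ.- (+ 2 ℤ.* j)) ⟩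
    ℤ.- (+ 2 ℤ.* j)                           ≡⟨ cong ℤ.-_ (ℤP.*-comm (+ 2) j) ⟩
    ℤ.- (j ℤ.* + 2)                           ≡⟨ ℤP.neg-distribˡ-* j (+ 2) ⟩
    ℤ.- j ℤ.* + 2                             ∎)))))
  where open ≡-Reasoning

module _ (A B : ℤ) (mono : Monogenic (F2 A B)) where
  open Quartic A B
  open TowerSingular ℚᵒ A B using (θθ; ηη; singular-coordinate; singular₃-coordinate; κ-unit)
  open SingularElements QK.quadratic A B
  open Order integersᵒ
  open ℤ-Algebra ℚᵒ using (_+_; _*_; -_; ι-*; ι-+)

  quotient-factor : ∀ {w j} d → w ≡ + 1 ℤ.+ + 2 ℤ.* j → (d ℤ.* d) ℤD.∣ w →
      ¬ d ≡ + 0 × Σ ℤ λ k → w ≡ k ℤ.* (d ℤ.* d)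
  quotient-factor {w} {j} d w≡ d²∣w with Signed.∣ᵤ⇒∣ {d ℤ.* d} {w} d²∣w
  -- `Squarefree` also quantifies over d = 0. Then w = 0, which oddness excludes, so 1/d exists.
  ... | Signed.divides k eq = (λ { refl → odd≢0 j (trans (sym w≡) (trans eq (ℤP.*-zeroʳ k))) }) , k , eq

  monogenic⇒W-squarefree : ∀ {s j} → IsSign s → W s A B ≡ + 1 ℤ.+ + 2 ℤ.* j → Squarefree (W s A B)
  monogenic⇒W-squarefree {s} {j} sign odd d d²∣W =
    let d≢0 , k , W≡ = quotient-factor {W s A B} {j} d odd d²∣W
        e , de≡1 = reciprocal d d≢0
        α∈ = monogenic⇒∈ mono (biquadratic (k ℤ.* s) (k ℤ.* d) (A ℤ.+ + 4 ℤ.* s) (W s A B))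
            (singular θθ ηη (κ e) s)
               (singular-integral θθ ηη s k d (s*s≡1 sign) (κ-unit d de≡1) W≡)
    in IsInt-reciprocal d de≡1 (subst IsInt (solve 1 (λ e → :- (:- e) := e) refl e)
         (Mem-neg (subst IsInt (singular-coordinate e s) (proj₂ (proj₂ α∈)))))
    where
    open ℤ-Algebra.Solver ℚᵒ
    s*s≡1 : ∀ {s} → IsSign s → s ℤ.* s ≡ + 1
    s*s≡1 plus  = refl
    s*s≡1 minus = refl

  -- As W₃ = k d² = 1 + 2j, we have 1/d = k d − j (2/d).
  monogenic⇒W₃-squarefree : ∀ {j} → W₃ A B ≡ + 1 ℤ.+ + 2 ℤ.* j → Squarefree (W₃ A B)
  monogenic⇒W₃-squarefree {j} odd d d²∣W =
    let d≢0 , k , W≡ = quotient-factor {W₃ A B} {j} d odd d²∣W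
        e , de≡1 = reciprocal d d≢0
        α∈ = monogenic⇒∈ mono (ℤ.- k ∷ + 0 ∷ []) (singular₃ θθ ηη (κ e))
            (singular₃-integral θθ ηη k d (κ-unit d de≡1) W≡)
    in IsInt-reciprocal d de≡1 (subst IsInt (half k e de≡1 (trans (sym W≡) odd))
         (Mem-- (Mem-* (IsInt-toQ k) (IsInt-toQ d))
           (Mem-* (IsInt-toQ j) (subst IsInt (singular₃-coordinate e) (proj₂ (proj₁ α∈))))))
    where
    open ℤ-Algebra.Solver ℚᵒ
    half : ∀ k e → toQ d * e ≡ 1ℚ → k ℤ.* (d ℤ.* d) ≡ + 1 ℤ.+ + 2 ℤ.* j →
           toQ k * toQ d + - (toQ j * (toQ (+ 2) * e)) ≡ e
    half k e de≡1 kd²≡ = begin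
      toQ k * toQ d + - (toQ j * (toQ (+ 2) * e))
        ≡⟨ cong (λ x → x + - (toQ j * (toQ (+ 2) * e))) (solve 2 (λ k d → k :* d
            := k :* d :* con (+ 1)) refl (toQ k) (toQ d)) ⟩
      toQ k * toQ d * 1ℚ + - (toQ j * (toQ (+ 2) * e))
        ≡⟨ cong (λ x → toQ k * toQ d * x + - (toQ j * (toQ (+ 2) * e))) de≡1 ⟨
      toQ k * toQ d * (toQ d * e) + - (toQ j * (toQ (+ 2) * e))
        ≡⟨ solve 4 (λ k d e j → k :* d :* (d :* e) :+ :- (j :* (con (+ 2) :* e))
            := (k :* (d :* d) :+ :- (con (+ 2) :* j)) :* e) refl (toQ k) (toQ d) e (toQ j) ⟩
      (toQ k * (toQ d * toQ d) + - (toQ (+ 2) * toQ j)) * e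
        ≡⟨ cong (λ x → (x + - (toQ (+ 2) * toQ j)) * e)
            (trans (cong (toQ k *_) (sym (ι-* d d))) (trans (sym (ι-* k (d ℤ.* d))) (trans (cong toQ kd²≡)
             (trans (ι-+ (+ 1) (+ 2 ℤ.* j)) (cong (λ x → toQ (+ 1) + x) (ι-* (+ 2) j)))))) ⟩
      (toQ (+ 1) + toQ (+ 2) * toQ j + - (toQ (+ 2) * toQ j)) * e
        ≡⟨ solve 2 (λ j e → (con (+ 1) :+ con (+ 2) :* j :+ :- (con (+ 2) :* j)) :* e := e) refl (toQ j) e ⟩
      e ∎
      where open ≡-Reasoning

-- Irreducibility

*≡0⇒ : ∀ a b → a ℚ.* b ≡ 0ℚ → a ≡ 0ℚ ⊎ b ≡ 0ℚ
*≡0⇒ a b ab≡0 with a ℚP.≟ 0ℚ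
... | yes a≡0 = inj₁ a≡0
... | no a≢0 = inj₂ (begin
  b                          ≡⟨ ℚP.*-identityˡ b ⟨
  1ℚ ℚ.* b                   ≡⟨ cong (ℚ._* b) (ℚP.*-inverseˡ a {{a-nonZero}}) ⟨
  a⁻¹ ℚ.* a ℚ.* b            ≡⟨ ℚP.*-assoc a⁻¹ a b ⟩
  a⁻¹ ℚ.* (a ℚ.* b)          ≡⟨ cong (a⁻¹ ℚ.*_) ab≡0 ⟩
  a⁻¹ ℚ.* 0ℚ                 ≡⟨ ℚP.*-zeroʳ a⁻¹ ⟩
  0ℚ                         ∎)
  where
  open ≡-Reasoning
  a-nonZero : ℚ.NonZero a
  a-nonZero = ℚ.≢-nonZero a≢0
  a⁻¹ : ℚ
  a⁻¹ = ℚ.1/_ a {{a-nonZero}}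

Degree : PolyQ → ℕ → Set
Degree p n = ¬ coeff p n ≡ 0ℚ × (∀ m → n ℕ.< m → coeff p m ≡ 0ℚ)

degree : ∀ p → p ≈ₚ [] ⊎ Σ ℕ (Degree p)
degree [] = inj₁ (λ _ → refl)
degree (c ∷ p) with degree p | c ℚP.≟ 0ℚ
... | inj₂ (n , ≢0 , above) | _ = inj₂ (suc n , ≢0 , λ { (suc m) (ℕ.s≤s n<m) → above m n<m })
... | inj₁ p≈[] | yes c≡0 = inj₁ λ { zero → c≡0 ; (suc n) → p≈[] n }
... | inj₁ p≈[] | no c≢0 = inj₂ (0 , c≢0 , λ { (suc m) _ → p≈[] m })

≢0⇒Degree : ∀ p {k} → ¬ coeff p k ≡ 0ℚ → Σ ℕ λ n → Degree p n × k ℕ.≤ n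
≢0⇒Degree p {k} ≢0 with degree p
... | inj₁ p≈[] = ⊥-elim (≢0 (p≈[] k))
... | inj₂ (n , deg) = n , deg , ℕP.≮⇒≥ (λ n<k → ≢0 (proj₂ deg k n<k))

Degree-unique : ∀ p q {m n} → p ≈ₚ q → Degree p m → Degree q n → m ≡ n
Degree-unique p q {m} {n} p≈q (m≢0 , above-m) (n≢0 , above-n) with ℕP.<-cmp m n
... | tri< m<n _ _ = ⊥-elim (n≢0 (trans (sym (p≈q n)) (above-m n m<n)))
... | tri≈ _ m≡n _ = m≡n
... | tri> _ _ n<m = ⊥-elim (m≢0 (trans (p≈q m) (above-n m n<m)))

*ₚ-zeroˡ : ∀ p q → p ≈ₚ [] → (p *ₚ q) ≈ₚ []
*ₚ-zeroˡ []      q p≈[] n = refl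
*ₚ-zeroˡ (c ∷ p) q p≈[] n = trans (coeff-∷* c p q n)
  (trans (cong₂ ℚ._+_ (trans (cong (ℚ._* coeff q n) (p≈[] 0)) (ℚP.*-zeroˡ (coeff q n))) (tail n))
    (ℚP.+-identityˡ 0ℚ))
  where
  tail : ∀ n → coeff (0ℚ ∷ (p *ₚ q)) n ≡ 0ℚ
  tail zero    = refl
  tail (suc n) = *ₚ-zeroˡ p q (λ k → p≈[] (suc k)) n

-- The head coefficient of p is peeled off. If p has degree 0, its tail is zero and the product is a
-- multiple of q. Otherwise the head's contribution ends at degree n, and beyond it the product is
-- the tail's product shifted by one.
Degree-* : ∀ p q {m n} → Degree p m → Degree q n → Degree (p *ₚ q) (m ℕ.+ n)
Degree-* []      q         (≢0 , _)       _ = ⊥-elim (≢0 refl)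
Degree-* (c ∷ p) q {zero} {n} (c≢0 , above) (≢0 , above-q) = leading , higher
  where
  product : ∀ k → coeff ((c ∷ p) *ₚ q) k ≡ c ℚ.* coeff q k
  product k =
    trans (coeff-∷* c p q k)
        (trans (cong (λ x → c ℚ.* coeff q k ℚ.+ x) (tail k)) (ℚP.+-identityʳ (c ℚ.* coeff q k)))
    where
    tail : ∀ k → coeff (0ℚ ∷ (p *ₚ q)) k ≡ 0ℚ
    tail zero    = refl
    tail (suc k) = *ₚ-zeroˡ p q (λ j → above (suc j) (ℕ.s≤s ℕ.z≤n)) k
  leading : ¬ coeff ((c ∷ p) *ₚ q) n ≡ 0ℚ
  leading eq with *≡0⇒ c (coeff q n) (trans (sym (product n)) eq)
  ... | inj₁ c≡0 = c≢0 c≡0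
  ... | inj₂ ≡0  = ≢0 ≡0
  higher : ∀ k → n ℕ.< k → coeff ((c ∷ p) *ₚ q) k ≡ 0ℚ
  higher k n<k = trans (product k) (trans (cong (c ℚ.*_) (above-q k n<k)) (ℚP.*-zeroʳ c))
Degree-* (c ∷ p) q {suc m} {n} (≢0 , above) deg-q@(_ , above-q) =
    (λ eq → proj₁ ih (trans (sym (product (m ℕ.+ n) (ℕP.m≤n+m n m))) eq))
  , (λ { (suc k) (ℕ.s≤s m+n<k) → trans (product k (ℕP.≤-trans (ℕP.m≤n+m n m) (ℕP.<⇒≤ m+n<k)))
      (proj₂ ih k m+n<k) })
  where
  ih : Degree (p *ₚ q) (m ℕ.+ n)
  ih = Degree-* p q (≢0 , λ k m<k → above (suc k) (ℕ.s≤s m<k)) deg-q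
  product : ∀ k → n ℕ.≤ k → coeff ((c ∷ p) *ₚ q) (suc k) ≡ coeff (p *ₚ q) k
  product k n≤k = trans (coeff-∷* c p q (suc k))
    (trans (cong (λ x → c ℚ.* x ℚ.+ coeff (p *ₚ q) k) (above-q (suc k) (ℕ.s≤s n≤k)))
      (trans (cong (ℚ._+ coeff (p *ₚ q) k) (ℚP.*-zeroʳ c)) (ℚP.+-identityˡ (coeff (p *ₚ q) k))))

Degree-divisor : ∀ f p {m n} → Degree f m → Degree p n → f ∣ₚ p → m ℕ.≤ n
Degree-divisor f p {m} {n} deg-f deg-p (q , qf≈p) with degree q
... | inj₁ q≈[] = ⊥-elim (proj₁ deg-p (trans (sym (qf≈p n)) (*ₚ-zeroˡ q f q≈[] n)))
... | inj₂ (k , deg-q) =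
  subst (m ℕ.≤_) (Degree-unique (q *ₚ f) p qf≈p (Degree-* q f deg-q deg-f) deg-p) (ℕP.m≤n+m m k)

Degree-f : ∀ A B → Degree (monic (F2 A B)) 4
Degree-f A B = (λ ()) , λ { (suc (suc (suc (suc (suc m))))) _ → refl ; 1 (ℕ.s≤s ()) ; 2 (ℕ.s≤s (ℕ.s≤s ()))
                          ; 3 (ℕ.s≤s (ℕ.s≤s (ℕ.s≤s ()))) ; 4 (ℕ.s≤s (ℕ.s≤s (ℕ.s≤s (ℕ.s≤s ())))) }

-- In a factorisation of positive degrees both factors have degree below 4, so f can divide neither.
prime-quartic⇒irreducible : ∀ A B →
    (∀ g h → (g *ₚ h) ≈ₚ monic (F2 A B) → monic (F2 A B) ∣ₚ g ⊎ monic (F2 A B) ∣ₚ h) →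
                            IrreducibleQ (monic (F2 A B))
prime-quartic⇒irreducible A B prime = (4 , ℕ.s≤s ℕ.z≤n , λ ()) , irreducible
  where
  irreducible : ¬ (Σ PolyQ λ g → Σ PolyQ λ h → PosDeg g × PosDeg h × ((g *ₚ h) ≈ₚ monic (F2 A B)))
  irreducible (g , h , (_ , 1≤i , gᵢ≢0) , (_ , 1≤j , hⱼ≢0) , gh≈f) with ≢0⇒Degree g gᵢ≢0 | ≢0⇒Degree h hⱼ≢0
  ... | m , deg-g , i≤m | n , deg-h , j≤n = contradiction (prime g h gh≈f)
    where
    m+n≡4 : m ℕ.+ n ≡ 4
    m+n≡4 = Degree-unique (g *ₚ h) (monic (F2 A B)) gh≈f (Degree-* g h deg-g deg-h) (Degree-f A B)
    contradiction : ¬ (monic (F2 A B) ∣ₚ g ⊎ monic (F2 A B) ∣ₚ h)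
    contradiction (inj₁ f∣g) =
      ℕP.<⇒≱ (subst (m ℕ.<_) m+n≡4 (ℕP.m<m+n m (ℕP.≤-trans 1≤j j≤n)))
          (Degree-divisor (monic (F2 A B)) g (Degree-f A B) deg-g f∣g)
    contradiction (inj₂ f∣h) =
      ℕP.<⇒≱ (subst (n ℕ.<_) m+n≡4 (ℕP.m<n+m n (ℕP.≤-trans 1≤i i≤m)))
          (Degree-divisor (monic (F2 A B)) h (Degree-f A B) deg-h f∣h)

-- Anisotropy of the norm form by reduction modulo 2

record Hom (R S : ℤ-Algebra) : Set where
  private
    module R = ℤ-Algebra R
    module S = ℤ-Algebra S
  field
    ⟦_⟧     : R.Carrier → S.Carrier
    +-homo  : ∀ x y → ⟦ x R.+ y ⟧ ≡ ⟦ x ⟧ S.+ ⟦ y ⟧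
    *-homo  : ∀ x y → ⟦ x R.* y ⟧ ≡ ⟦ x ⟧ S.* ⟦ y ⟧
    neg-homo : ∀ x → ⟦ R.- x ⟧ ≡ S.- ⟦ x ⟧
    ι-homo  : ∀ i → ⟦ R.ι i ⟧ ≡ S.ι i

module QuadraticHom {R S : ℤ-Algebra} (φ : Hom R S) {p q p′ q′}
  (p≡ : Hom.⟦_⟧ φ p ≡ p′) (q≡ : Hom.⟦_⟧ φ q ≡ q′) where
  open Hom φ
  private
    module R = ℤ-Algebra R
    module S = ℤ-Algebra S
    module QR = Quadratic R p q
    module QS = Quadratic S p′ q′

  quadraticHom : Hom QR.quadratic QS.quadratic
  quadraticHom = record
    { ⟦_⟧ = λ (x , y) → ⟦ x ⟧ , ⟦ y ⟧
    ; +-homo = λ (x , y) (z , w) → cong₂ _,_ (+-homo x z) (+-homo y w)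
    ; *-homo = λ (x , y) (z , w) → cong₂ _,_
        (trans (+-homo _ _) (cong₂ S._+_ (*-homo x z) (trans (*-homo q _) (cong₂ S._*_ q≡ (*-homo y w)))))
        (trans (+-homo _ _) (cong₂ S._+_ (trans (+-homo _ _) (cong₂ S._+_ (*-homo x w) (*-homo y z)))
          (trans (*-homo p _) (cong₂ S._*_ p≡ (*-homo y w)))))
    ; neg-homo = λ (x , y) → cong₂ _,_ (neg-homo x) (neg-homo y)
    ; ι-homo = λ i → cong₂ _,_ (ι-homo i) (ι-homo (+ 0)) }

  norm-homo : ∀ a → ⟦ QR.norm a ⟧ ≡ QS.norm (Hom.⟦_⟧ quadraticHom a)
  norm-homo (x , y) = trans (+-homo _ _) (cong₂ S._+_
    (trans (+-homo _ _) (cong₂ S._+_ (*-homo x x) (trans (*-homo p _) (cong₂ S._*_ p≡ (*-homo x y)))))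
    (trans (*-homo _ _) (cong₂ S._*_ (trans (neg-homo q) (cong S.-_ q≡)) (*-homo y y))))

module TowerNorm (F : ℤ-Algebra) (A B : ℤ) where
  open Tower F A B
  open ℤ-Algebra F

  opaque
    norm : K.Carrier → Carrier
    norm a = QE.norm (QK.norm a)

    annihilates : ∀ {a x y z w} → a K.* ((x , y) , (z , w)) ≡ K.0# →
      norm a * x ≡ 0# × norm a * y ≡ 0# × norm a * z ≡ 0# × norm a * w ≡ 0#
    annihilates {a} {x} {y} {z} {w} ab≡0 =
      let n₁ , n₂ = QK.norm-annihilates {a} {x , y} {z , w} ab≡0
          nx , ny = QE.norm-annihilates {QK.norm a} {x} {y} n₁
          nz , nw = QE.norm-annihilates {QK.norm a} {z} {w} n₂
      in nx , ny , nz , nw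

    norm-scale : ∀ c x y z w →
        norm ((c * x , c * y) , (c * z , c * w)) ≡ c * c * (c * c) * norm ((x , y) , (z , w))
    norm-scale c x y z w = begin
      QE.norm (QK.norm ((c * x , c * y) , (c * z , c * w)))
        ≡⟨ cong₂ (λ u v → QE.norm (QK.norm (u , v))) (QE.embed-scale c x y) (QE.embed-scale c z w) ⟨
      QE.norm (QK.norm (QE.embed c E.* (x , y) , QE.embed c E.* (z , w)))
        ≡⟨ cong QE.norm (QK.norm-scale (QE.embed c) (x , y) (z , w)) ⟩
      QE.norm (QE.embed c E.* QE.embed c E.* n)
        ≡⟨ cong (λ d → QE.norm (d E.* n)) (QE.embed-* c c) ⟨
      QE.norm (QE.embed (c * c) E.* n)
        ≡⟨ cong QE.norm (QE.embed-scale (c * c) (proj₁ n) (proj₂ n)) ⟩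
      QE.norm (c * c * proj₁ n , c * c * proj₂ n)
        ≡⟨ QE.norm-scale (c * c) (proj₁ n) (proj₂ n) ⟩
      c * c * (c * c) * QE.norm n ∎
      where
      open ≡-Reasoning
      n : E.Carrier
      n = QK.norm ((x , y) , (z , w))

-- The target has its own parameters so that reduction modulo 2 can land in the single tower with A′
-- = B′ = 1. The inclusion of ℤ in ℚ keeps A and B.
module TowerHom {F G : ℤ-Algebra} (φ : Hom F G) (A B A′ B′ : ℤ)
  (A≡ : Hom.⟦_⟧ φ (ℤ-Algebra.ι F A) ≡ ℤ-Algebra.ι G A′)
    (B≡ : Hom.⟦_⟧ φ (ℤ-Algebra.ι F B) ≡ ℤ-Algebra.ι G B′) where
  open Hom φ
  private
    module F = ℤ-Algebra F
    module G = ℤ-Algebra G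
    module TF = Tower F A B
    module TG = Tower G A′ B′

  towerMap : TF.K.Carrier → TG.K.Carrier
  towerMap ((x , y) , (z , w)) = (⟦ x ⟧ , ⟦ y ⟧) , (⟦ z ⟧ , ⟦ w ⟧)

  p≡ : ⟦ TF.p ⟧ ≡ TG.p
  p≡ = trans (neg-homo (F.ι A)) (cong G.-_ A≡)
  q≡ : ⟦ TF.q ⟧ ≡ TG.q
  q≡ = trans (+-homo (F.ι (+ 2)) (F.- F.ι B))
      (cong₂ G._+_ (ι-homo (+ 2)) (trans (neg-homo (F.ι B)) (cong G.-_ B≡)))

  module HE = QuadraticHom φ {TF.p} {TF.q} {TG.p} {TG.q} p≡ q≡
  module HK = QuadraticHom HE.quadraticHom {TF.η} {TF.E.- TF.E.1#} {TG.η} {TG.E.- TG.E.1#}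
    (cong₂ _,_ (ι-homo (+ 0)) (ι-homo (+ 1)))
    (trans (Hom.neg-homo HE.quadraticHom TF.E.1#) (cong TG.E.-_ (Hom.ι-homo HE.quadraticHom (+ 1))))

  opaque
    unfolding TowerNorm.norm

    tower-norm : ∀ a → ⟦ TowerNorm.norm F A B a ⟧ ≡ TowerNorm.norm G A′ B′ (towerMap a)
    tower-norm a = trans (HE.norm-homo (TF.QK.norm a)) (cong TG.QE.norm (HK.norm-homo a))

ℤ-algebra : ℤ-Algebra
ℤ-algebra = record
  { Carrier = ℤ ; _+_ = ℤ._+_ ; _*_ = ℤ._*_ ; -_ = ℤ.-_ ; ι = λ i → i
  ; isCommutativeRing = ℤP.+-*-isCommutativeRing
  ; ι-+ = λ _ _ → refl ; ι-* = λ _ _ → refl ; ι-neg = λ _ → refl }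

parityℤ : ℤ → Parity
parityℤ i = parity ℤ.∣ i ∣

parity-suc-+ : ∀ m n → parity (suc m) ℙ.+ parity (suc n) ≡ parity m ℙ.+ parity n
parity-suc-+ m n =
  trans (cancel (parity (suc m)) (parity (suc n))) (cong₂ ℙ._+_ (ℙP.suc-homo-⁻¹ m) (ℙP.suc-homo-⁻¹ n))
  where
  cancel : ∀ x y → x ℙ.+ y ≡ x ℙ.⁻¹ ℙ.+ y ℙ.⁻¹
  cancel 0ℙ 0ℙ = refl
  cancel 0ℙ 1ℙ = refl
  cancel 1ℙ 0ℙ = refl
  cancel 1ℙ 1ℙ = refl

parity-⊖ : ∀ m n → parityℤ (m ℤ.⊖ n) ≡ parity m ℙ.+ parity n
parity-⊖ zero    zero    = refl
parity-⊖ zero    (suc n) = refl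
parity-⊖ (suc m) zero    = sym (ℙP.+-identityʳ (parity (suc m)))
parity-⊖ (suc m) (suc n) = trans (cong parityℤ (ℤP.[1+m]⊖[1+n]≡m⊖n m n))
  (trans (parity-⊖ m n) (sym (parity-suc-+ m n)))

parityℤ-+ : ∀ i j → parityℤ (i ℤ.+ j) ≡ parityℤ i ℙ.+ parityℤ j
parityℤ-+ (+ m)    (+ n)    = ℙP.+-homo-+ m n
parityℤ-+ (+ m)    -[1+ n ] = parity-⊖ m (suc n)
parityℤ-+ -[1+ m ] (+ n)    = trans (parity-⊖ n (suc m)) (ℙP.+-comm (parity n) (parity (suc m)))
parityℤ-+ -[1+ m ] -[1+ n ] = trans (ℙP.+-homo-+ m n) (sym (parity-suc-+ m n))

parityℤ-* : ∀ i j → parityℤ (i ℤ.* j) ≡ parityℤ i ℙ.* parityℤ j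
parityℤ-* i j = trans (cong parity (ℤP.abs-* i j)) (ℙP.*-homo-* ℤ.∣ i ∣ ℤ.∣ j ∣)

parityℤ-neg : ∀ i → parityℤ (ℤ.- i) ≡ parityℤ i
parityℤ-neg i = cong parity (ℤP.∣-i∣≡∣i∣ i)

parity-algebra : ℤ-Algebra
parity-algebra = record
  { Carrier = Parity ; _+_ = ℙ._+_ ; _*_ = ℙ._*_ ; -_ = λ x → x ; ι = parityℤ
  ; isCommutativeRing = ℙP.+-*-isCommutativeRing
  ; ι-+ = parityℤ-+ ; ι-* = parityℤ-* ; ι-neg = parityℤ-neg }

reduction : Hom ℤ-algebra parity-algebra
reduction = record
  { ⟦_⟧ = parityℤ ; +-homo = parityℤ-+ ; *-homo = parityℤ-* ; neg-homo = parityℤ-neg ; ι-homo = λ _ → refl }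

inclusion : Hom ℤ-algebra ℚᵒ
inclusion = record
  { ⟦_⟧ = toQ ; +-homo = toQ-+ᵒ ; *-homo = toQ-*ᵒ ; neg-homo = toQ-negᵒ ; ι-homo = λ _ → refl }

opaque
  unfolding TowerNorm.norm

  -- For A = B = 1 modulo 2 the quartic is the fifth cyclotomic polynomial, which is irreducible
  -- over 𝔽₂. The tower is 𝔽₂ ⊂ 𝔽₄ ⊂ 𝔽₁₆, and a norm between fields vanishes only at zero; sixteen
  -- evaluations confirm it.
  parity-norm-anisotropic : ∀ x y z w → TowerNorm.norm parity-algebra (+ 1) (+ 1) ((x , y) , (z , w)) ≡ 0ℙ →
                            x ≡ 0ℙ × y ≡ 0ℙ × z ≡ 0ℙ × w ≡ 0ℙ
  parity-norm-anisotropic 0ℙ 0ℙ 0ℙ 0ℙ _ = refl , refl , refl , refl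
  parity-norm-anisotropic 0ℙ 0ℙ 0ℙ 1ℙ ()
  parity-norm-anisotropic 0ℙ 0ℙ 1ℙ 0ℙ ()
  parity-norm-anisotropic 0ℙ 0ℙ 1ℙ 1ℙ ()
  parity-norm-anisotropic 0ℙ 1ℙ 0ℙ 0ℙ ()
  parity-norm-anisotropic 0ℙ 1ℙ 0ℙ 1ℙ ()
  parity-norm-anisotropic 0ℙ 1ℙ 1ℙ 0ℙ ()
  parity-norm-anisotropic 0ℙ 1ℙ 1ℙ 1ℙ ()
  parity-norm-anisotropic 1ℙ 0ℙ 0ℙ 0ℙ ()
  parity-norm-anisotropic 1ℙ 0ℙ 0ℙ 1ℙ ()
  parity-norm-anisotropic 1ℙ 0ℙ 1ℙ 0ℙ ()
  parity-norm-anisotropic 1ℙ 0ℙ 1ℙ 1ℙ ()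
  parity-norm-anisotropic 1ℙ 1ℙ 0ℙ 0ℙ ()
  parity-norm-anisotropic 1ℙ 1ℙ 0ℙ 1ℙ ()
  parity-norm-anisotropic 1ℙ 1ℙ 1ℙ 0ℙ ()
  parity-norm-anisotropic 1ℙ 1ℙ 1ℙ 1ℙ ()

even⇒2∣ : ∀ n → parity n ≡ 0ℙ → 2 ℕD.∣ n
even⇒2∣ zero          _    = ℕD.divides 0 refl
even⇒2∣ (suc (suc n)) even with even⇒2∣ n even
... | ℕD.divides k eq = ℕD.divides (suc k) (cong (λ m → suc (suc m)) eq)

halve : ∀ i → parityℤ i ≡ 0ℙ → Σ ℤ λ j → i ≡ + 2 ℤ.* j
halve i even with Signed.∣ᵤ⇒∣ {+ 2} {i} (even⇒2∣ ℤ.∣ i ∣ even)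
... | Signed.divides j eq = j , trans eq (ℤP.*-comm j (+ 2))

2^∣⇒≡0 : ∀ i → (∀ n → Σ ℤ λ j → i ≡ (+ 2) ℤ.^ n ℤ.* j) → i ≡ + 0
2^∣⇒≡0 i div with i ℤP.≟ + 0
... | yes i≡0 = i≡0
... | no i≢0 = ⊥-elim (ℕP.<⇒≱ (n<m^n {2} (ℕ.s≤s (ℕ.s≤s ℕ.z≤n)) ℤ.∣ i ∣)
    (ℕD.∣⇒≤ {{ℕ.≢-nonZero (λ e → i≢0 (ℤP.∣i∣≡0⇒i≡0 e))}} (ℕD.divides ℤ.∣ j ∣ (begin
      ℤ.∣ i ∣                                     ≡⟨ cong ℤ.∣_∣ (proj₂ (div ℤ.∣ i ∣)) ⟩
      ℤ.∣ (+ 2) ℤ.^ ℤ.∣ i ∣ ℤ.* j ∣               ≡⟨ ℤP.abs-* ((+ 2) ℤ.^ ℤ.∣ i ∣) j ⟩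
      ℤ.∣ (+ 2) ℤ.^ ℤ.∣ i ∣ ∣ ℕ.* ℤ.∣ j ∣         ≡⟨ cong (ℕ._* ℤ.∣ j ∣) (abs-^ (+ 2) ℤ.∣ i ∣) ⟩
      2 ℕ.^ ℤ.∣ i ∣ ℕ.* ℤ.∣ j ∣                   ≡⟨ ℕP.*-comm (2 ℕ.^ ℤ.∣ i ∣) ℤ.∣ j ∣ ⟩
      ℤ.∣ j ∣ ℕ.* 2 ℕ.^ ℤ.∣ i ∣                   ∎))))
  where
  open ≡-Reasoning
  j : ℤ
  j = proj₁ (div ℤ.∣ i ∣)

module OddNorm (A B : ℤ) (A-odd : parityℤ A ≡ 1ℙ) (B-odd : parityℤ B ≡ 1ℙ) where
  open TowerNorm ℤ-algebra A B
  module Mod2 = TowerHom reduction A B (+ 1) (+ 1) A-odd B-odd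

  evens : ∀ {x y z w} → norm ((x , y) , (z , w)) ≡ + 0 →
          parityℤ x ≡ 0ℙ × parityℤ y ≡ 0ℙ × parityℤ z ≡ 0ℙ × parityℤ w ≡ 0ℙ
  evens {x} {y} {z} {w} n≡0 = parity-norm-anisotropic (parityℤ x) (parityℤ y) (parityℤ z) (parityℤ w)
    (trans (sym (Mod2.tower-norm ((x , y) , (z , w)))) (cong parityℤ n≡0))

  Divisible : ℕ → ℤ → Set
  Divisible n i = Σ ℤ λ j → i ≡ (+ 2) ℤ.^ n ℤ.* j

  -- Infinite descent, phrased as divisibility by every power of 2 so that it recurses on n. A zero
  -- of the norm has even coordinates; the form is homogeneous of degree 4, so cancelling 16 shows
  -- that the halved vector is again a zero.
  divisible : ∀ n {x y z w} → norm ((x , y) , (z , w)) ≡ + 0 →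
              Divisible n x × Divisible n y × Divisible n z × Divisible n w
  divisible zero    {x} {y} {z} {w} _ = trivial x , trivial y , trivial z , trivial w
    where
    trivial : ∀ i → Divisible 0 i
    trivial i = i , sym (ℤP.*-identityˡ i)
  divisible (suc n) {x} {y} {z} {w} n≡0 =
    let ex , ey , ez , ew = evens n≡0
        x′ , x≡ = halve x ex
        y′ , y≡ = halve y ey
        z′ , z≡ = halve z ez
        w′ , w≡ = halve w ew
        dx , dy , dz , dw = divisible n {x′} {y′} {z′} {w′} (halved x≡ y≡ z≡ w≡)
    in double x≡ dx , double y≡ dy , double z≡ dz , double w≡ dw
    where
    double : ∀ {i j} → i ≡ + 2 ℤ.* j → Divisible n j → Divisible (suc n) i
    double i≡ (k , j≡) = k , trans i≡ (trans (cong (+ 2 ℤ.*_) j≡) (sym (ℤP.*-assoc (+ 2) ((+ 2) ℤ.^ n) k)))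
    halved : ∀ {x′ y′ z′ w′} → x ≡ + 2 ℤ.* x′ → y ≡ + 2 ℤ.* y′ → z ≡ + 2 ℤ.* z′ → w ≡ + 2 ℤ.* w′ →
             norm ((x′ , y′) , (z′ , w′)) ≡ + 0
    halved {x′} {y′} {z′} {w′} refl refl refl refl =
      [ (λ ()) , (λ e → e) ]′ (ℤP.i*j≡0⇒i≡0∨j≡0 (+ 16) (trans (sym (norm-scale (+ 2) x′ y′ z′ w′)) n≡0))

  anisotropic : ∀ {x y z w} → norm ((x , y) , (z , w)) ≡ + 0 → x ≡ + 0 × y ≡ + 0 × z ≡ + 0 × w ≡ + 0
  anisotropic {x} {y} {z} {w} n≡0 =
      2^∣⇒≡0 x (λ n → proj₁ (divisible n n≡0))
    , 2^∣⇒≡0 y (λ n → proj₁ (proj₂ (divisible n n≡0)))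
    , 2^∣⇒≡0 z (λ n → proj₁ (proj₂ (proj₂ (divisible n n≡0))))
    , 2^∣⇒≡0 w (λ n → proj₂ (proj₂ (proj₂ (divisible n n≡0))))

open import Data.Integer using (_+_; _-_; _*_)
open import Data.Integer.Divisibility using (_∣_)

cancel-toQ : ∀ {i} r x → ¬ i ≡ + 0 → r ≡ toQ i → r *ᵒ x ≡ 0ℚ → x ≡ 0ℚ
cancel-toQ {i} r x i≢0 r≡i rx≡0 with *≡0⇒ r x (trans (*≡*ᵒ r x) rx≡0)
... | inj₁ r≡0 = ⊥-elim (i≢0 (toQ-injective {i} {+ 0} (trans (sym r≡i) r≡0)))
... | inj₂ x≡0 = x≡0

module Domain (A B : ℤ) (A-odd : parityℤ A ≡ 1ℙ) (B-odd : parityℤ B ≡ 1ℙ) where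
  open Quartic A B
  open OddNorm A B A-odd B-odd using (anisotropic)
  open TowerNorm ℚᵒ A B
  module Normℤ = TowerNorm ℤ-algebra A B
  module Inclusion = TowerHom inclusion A B A B refl refl

  ι-scale : ∀ d x y z w →
      K.ι d K.* ((x , y) , (z , w)) ≡ ((toQ d *ᵒ x , toQ d *ᵒ y) , (toQ d *ᵒ z , toQ d *ᵒ w))
  ι-scale d x y z w = trans (QK.embed-scale (E.ι d) (x , y) (z , w))
    (cong₂ _,_ (QE.embed-scale (toQ d) x y) (QE.embed-scale (toQ d) z w))

  -- The norm is tested over ℤ, where `anisotropic` applies, and carried to ℚ by
  -- `Inclusion.tower-norm`. A nonzero norm of a multiplies every coordinate of b to zero when a b =
  -- 0, and can be cancelled.
  integral-zero-or-cancellable : ∀ x y z w → let a = Inclusion.towerMap ((x , y) , (z , w)) in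
    a ≡ K.0# ⊎ (∀ b → a K.* b ≡ K.0# → b ≡ K.0#)
  integral-zero-or-cancellable x y z w with Normℤ.norm ((x , y) , (z , w)) ℤP.≟ + 0
  ... | yes n≡0 = let x≡0 , y≡0 , z≡0 , w≡0 = anisotropic n≡0 in
    inj₁ (cong₂ _,_ (cong₂ _,_ (cong toQ x≡0) (cong toQ y≡0)) (cong₂ _,_ (cong toQ z≡0) (cong toQ w≡0)))
  ... | no n≢0 = inj₂ λ ((r , s) , (t , u)) ab≡0 →
    let nr , ns , nt , nu = annihilates {a} {r} {s} {t} {u} ab≡0
        cancel : ∀ v → norm a *ᵒ v ≡ 0ℚ → v ≡ 0ℚ
        cancel v = cancel-toQ (norm a) v n≢0 (sym (Inclusion.tower-norm ((x , y) , (z , w))))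
    in cong₂ _,_ (cong₂ _,_ (cancel r nr) (cancel s ns)) (cong₂ _,_ (cancel t nt) (cancel u nu))
    where
    a : K.Carrier
    a = Inclusion.towerMap ((x , y) , (z , w))

  domain-scaled : ∀ d a b x y z w → ¬ d ≡ + 0 → K.ι d K.* a ≡ Inclusion.towerMap ((x , y) , (z , w)) →
                  a K.* b ≡ K.0# → a ≡ K.0# ⊎ b ≡ K.0#
  domain-scaled d a@((r , s) , (t , u)) b x y z w d≢0 da≡ ab≡0 = split
      (integral-zero-or-cancellable x y z w)
    where
    da : K.Carrier
    da = Inclusion.towerMap ((x , y) , (z , w))
    split : da ≡ K.0# ⊎ (∀ b → da K.* b ≡ K.0# → b ≡ K.0#) → a ≡ K.0# ⊎ b ≡ K.0#
    split (inj₁ da≡0) = inj₁ (cong₂ _,_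
        (cong₂ _,_ (cancel r (cong (λ k → proj₁ (proj₁ k)) scaled≡0))
          (cancel s (cong (λ k → proj₂ (proj₁ k)) scaled≡0)))
        (cong₂ _,_ (cancel t (cong (λ k → proj₁ (proj₂ k)) scaled≡0))
          (cancel u (cong (λ k → proj₂ (proj₂ k)) scaled≡0))))
      where
      scaled≡0 : ((toQ d *ᵒ r , toQ d *ᵒ s) , (toQ d *ᵒ t , toQ d *ᵒ u)) ≡ K.0#
      scaled≡0 = trans (sym (ι-scale d r s t u)) (trans da≡ da≡0)
      cancel : ∀ v → toQ d *ᵒ v ≡ 0ℚ → v ≡ 0ℚ
      cancel v = cancel-toQ {d} (toQ d) v d≢0 refl
    split (inj₂ cancel) = inj₂ (cancel b (begin
      da K.* b                 ≡⟨ cong (K._* b) da≡ ⟨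
      K.ι d K.* a K.* b        ≡⟨ K.*-assoc (K.ι d) a b ⟩
      K.ι d K.* (a K.* b)      ≡⟨ cong (K.ι d K.*_) ab≡0 ⟩
      K.ι d K.* K.0#           ≡⟨ K.zeroʳ (K.ι d) ⟩
      K.0#                     ∎))
      where open ≡-Reasoning

  integral-coordinates : ∀ a → ℤθ.Mem a →
      Σ ℤ λ x → Σ ℤ λ y → Σ ℤ λ z → Σ ℤ λ w → a ≡ Inclusion.towerMap ((x , y) , (z , w))
  integral-coordinates _ (((x , x≡) , (y , y≡)) , ((z , z≡) , (w , w≡))) =
    x , y , z , w , cong₂ _,_ (cong₂ _,_ x≡ y≡) (cong₂ _,_ z≡ w≡)

  domain : ∀ a b → a K.* b ≡ K.0# → a ≡ K.0# ⊎ b ≡ K.0#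
  domain a b ab≡0 = unclear (ℤθ.clear a)
    where
    unclear : (Σ ℤ λ d → ¬ d ≡ + 0 × ℤθ.Mem (K.ι d K.* a)) → a ≡ K.0# ⊎ b ≡ K.0#
    unclear (d , d≢0 , da∈) =
      let x , y , z , w , da≡ = integral-coordinates (K.ι d K.* a) da∈ in
      domain-scaled d a b x y z w d≢0 da≡ ab≡0

  f-prime : ∀ g h → (g *ₚ h) ≈ₚ f → f ∣ₚ g ⊎ f ∣ₚ h
  f-prime g h gh≈f = [ (λ g≡0 → inj₁ (kernel g g≡0)) , (λ h≡0 → inj₂ (kernel h h≡0)) ]′
    (domain (eval g θ) (eval h θ) (trans (sym (eval-*ₚ g h θ)) (trans (eval-≈ₚ (g *ₚ h) f θ gh≈f) eval-f)))

-- Congruences modulo 4 and the equivalence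

module _ (A B k₁ k₂ k₁₂ j₃ : ℤ) (A-odd : parityℤ A ≡ 1ℙ) (B-odd : parityℤ B ≡ 1ℙ)
  (W₁≡ : W -[1+ 0 ] A B ≡ + 1 + + 2 * k₁) (W₂≡ : W (+ 1) A B ≡ + 1 + + 2 * k₂)
  (W₁₂≡ : W -[1+ 0 ] A B * W (+ 1) A B ≡ + 1 + + 4 * k₁₂) (W₃≡ : W₃ A B ≡ + 1 + + 2 * j₃) where

  squarefree⇒monogenic : Squarefree (W -[1+ 0 ] A B) → Squarefree (W (+ 1) A B) → Squarefree (W₃ A B) →
      Monogenic (F2 A B)
  squarefree⇒monogenic sf₁ sf₂ sf₃ =
      prime-quartic⇒irreducible A B (Domain.f-prime A B A-odd B-odd)
    , Quartic.closed⇒maximal A B (Closed.ℤ[θ]-closed A B k₁₂ W₁₂≡ sf₁ sf₂ sf₃)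

  monogenic⇔squarefree : Monogenic (F2 A B) ⇔
      (Squarefree (W -[1+ 0 ] A B) × Squarefree (W (+ 1) A B) × Squarefree (W₃ A B))
  monogenic⇔squarefree = mk⇔
    (λ mono → monogenic⇒W-squarefree A B mono {j = k₁} minus W₁≡
            , monogenic⇒W-squarefree A B mono {j = k₂} plus W₂≡
            , monogenic⇒W₃-squarefree A B mono {j = j₃} W₃≡)
    (λ (sf₁ , sf₂ , sf₃) → squarefree⇒monogenic sf₁ sf₂ sf₃)

odd-parity : ∀ a {A} → A ≡ + 1 + + 4 * a → parityℤ A ≡ 1ℙ
odd-parity a eq =
  trans (cong parityℤ eq) (trans (parityℤ-+ (+ 1) (+ 4 * a)) (cong (1ℙ ℙ.+_) (parityℤ-* (+ 4) a)))

1+quotient : ∀ A → (+ 4) ∣ (A - + 1) → Σ ℤ λ a → A ≡ + 1 + + 4 * a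
1+quotient A 4∣ with Signed.∣ᵤ⇒∣ {+ 4} {A - + 1} 4∣
... | Signed.divides a eq = a , (begin
  A                       ≡⟨ solve 1 (λ A → A := con (+ 1) :+ (A :+ :- con (+ 1))) refl A ⟩
  + 1 + (A - + 1)         ≡⟨ cong (λ x → + 1 + x) (trans eq (ℤP.*-comm a (+ 4))) ⟩
  + 1 + + 4 * a           ∎)
  where
  open ≡-Reasoning
  open ℤ-Algebra.Solver ℤ-algebra

module _ (a b : ℤ) where
  open ℤ-Algebra.Solver ℤ-algebra

  -- The nested form 1 + 2 (2 k) serves twice: read as 1 + 2 j it gives oddness, and in `product≡1`
  -- it gives the residue 1 modulo 4.
  W₁-odd : ∀ {A B} → A ≡ + 1 + + 4 * a → B ≡ + 1 + + 4 * b →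
      W -[1+ 0 ] A B ≡ + 1 + + 2 * (+ 2 * (b - + 2 * a))
  W₁-odd refl refl =
    solve 2 (λ a b → con (+ 1) :+ con (+ 4) :* b :+ con (+ 2) :+ con (+ 2) :* con -[1+ 0 ] :*
        (con (+ 1) :+ con (+ 4) :* a)
    := con (+ 1) :+ con (+ 2) :* (con (+ 2) :* (b :+ :- (con (+ 2) :* a)))) refl a b

  W₂-odd : ∀ {A B} → A ≡ + 1 + + 4 * a → B ≡ + 1 + + 4 * b →
      W (+ 1) A B ≡ + 1 + + 2 * (+ 2 * (b + + 2 * a + + 1))
  W₂-odd refl refl =
    solve 2 (λ a b → con (+ 1) :+ con (+ 4) :* b :+ con (+ 2) :+ con (+ 2) :* con (+ 1) :*
        (con (+ 1) :+ con (+ 4) :* a)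
    := con (+ 1) :+ con (+ 2) :* (con (+ 2) :* (b :+ con (+ 2) :* a :+ con (+ 1)))) refl a b

  W₃-odd : ∀ {A B} → A ≡ + 1 + + 4 * a → B ≡ + 1 + + 4 * b →
      W₃ A B ≡ + 1 + + 2 * (+ 8 * a * a + + 4 * a - + 8 * b + + 2)
  W₃-odd refl refl = solve 2
      (λ a b → let A = con (+ 1) :+ con (+ 4) :* a ; B = con (+ 1) :+ con (+ 4) :* b in
    A :* A :+ :- (con (+ 4) :* B) :+ con (+ 8)
    := con (+ 1) :+ con (+ 2) :*
        (con (+ 8) :* a :* a :+ con (+ 4) :* a :+ :- (con (+ 8) :* b) :+ con (+ 2))) refl a b

product≡1 : ∀ {x y} k l → x ≡ + 1 + + 2 * (+ 2 * k) → y ≡ + 1 + + 2 * (+ 2 * l) →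
    x * y ≡ + 1 + + 4 * (k + l + + 4 * k * l)
product≡1 k l x≡ y≡ = trans (cong₂ _*_ x≡ y≡)
  (solve 2 (λ k l → (con (+ 1) :+ con (+ 2) :* (con (+ 2) :* k)) :*
    (con (+ 1) :+ con (+ 2) :* (con (+ 2) :* l))
    := con (+ 1) :+ con (+ 4) :* (k :+ l :+ con (+ 4) :* k :* l)) refl k l)
  where open ℤ-Algebra.Solver ℤ-algebra

W₁≡ : ∀ A B → W -[1+ 0 ] A B ≡ B + + 2 - (+ 2) * A
W₁≡ A B = solve 2 (λ a b → b :+ con (+ 2) :+ con (+ 2) :* con -[1+ 0 ] :* a
    := b :+ con (+ 2) :+ :- (con (+ 2) :* a)) refl A B
  where open ℤ-Algebra.Solver ℤ-algebra

theorem1p2 : (A B : ℤ) → (+ 4) ∣ (A - + 1) → (+ 4) ∣ (B - + 1) →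
    (Monogenic (F2 A B) ⇔
    (Squarefree (B + + 2 - (+ 2) * A) × Squarefree (B + + 2 + (+ 2) * A) × Squarefree (A * A - (+ 4) * B + + 8)))
theorem1p2 A B 4∣A-1 4∣B-1 =
  let a , A≡ = 1+quotient A 4∣A-1
      b , B≡ = 1+quotient B 4∣B-1
      k₁ = b - + 2 * a
      k₂ = b + + 2 * a + + 1
  -- Only W₁ has to be rewritten: 2 · (+1) computes to 2, whereas adding 2 · (-1) · A and
  -- subtracting 2 · A agree only by a ring identity.
  in subst (λ w → Monogenic (F2 A B) ⇔ (Squarefree w × Squarefree (W (+ 1) A B) × Squarefree (W₃ A B)))
      (W₁≡ A B)
       (monogenic⇔squarefree A B (+ 2 * k₁) (+ 2 * k₂) (k₁ + k₂ + + 4 * k₁ * k₂)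
         (+ 8 * a * a + + 4 * a - + 8 * b + + 2)
         (odd-parity a A≡) (odd-parity b B≡) (W₁-odd a b A≡ B≡) (W₂-odd a b A≡ B≡)
         (product≡1 k₁ k₂ (W₁-odd a b A≡ B≡) (W₂-odd a b A≡ B≡)) (W₃-odd a b A≡ B≡))
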